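{- We have $$C_{1324,4231}(x)=\left(\prod_{i\ge 1}(1+x^i)+\sum_{a,b\ge 0}x^{(a+2)(b+1)}\cdot\prod_{i=1}^a(1+x^i)\cdot\prod_{i=1}^b(1+x^i)\right)^2.$$
   Context: $\mathrm{av}_n^k(B)$ is the number of permutations in $S_n$ with exactly $k$ inversions (pairs $i<j$ with $\pi_i>\pi_j$) that avoid every pattern in $B$; a permutation avoids a pattern $q$ if it has no subsequence order-isomorphic to $q$. If for every $k\ge0$ there are constants $m_k,c_k(B)$ with $\mathrm{av}_n^k(B)=c_k(B)$ for all $n\ge m_k$, then $(c_k(B))_{k\ge0}$ is the limit sequence of $B$ and $C_B(x)=\sum_{k\ge 0}c_k(B)x^k$ is its limit generating function (a formal power series); here $B=\{1324,4231\}$. -}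

module Defs where

open import Data.Fin using (Fin; toℕ; _<_; _>_; #_)
open import Data.Fin.Properties using (_≟_; _<?_; all?)
open import Data.List using (List; []; _∷_; length; filter; allFin; cartesianProduct; cartesianProductWith)
open import Data.List.Membership.Propositional using (_∈_; lose)
open import Data.List.Membership.Propositional.Properties using (∈-allFin; ∈-cartesianProductWith⁺)
open import Data.List.Relation.Unary.All as All using (All)
open import Data.List.Relation.Unary.Any as Any using (here)
open import Data.Nat as ℕ using (ℕ; zero; suc; _+_; _*_; _∸_)
open import Data.Nat.Properties as ℕₚ using (+-*-semiring)
open import Data.Product using (Σ; ∃-syntax; _×_; _,_; uncurry)
open import Data.Vec using (Vec; []; _∷_; lookup)
open import Data.Vec.Relation.Unary.AllPairs using (allPairs?)
open import Data.Vec.Relation.Unary.Unique.Propositional using (Unique)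
open import Function using (_⇔_; mk⇔; Equivalence)
open import Relation.Binary.PropositionalEquality using (_≡_; refl)
open import Relation.Nullary using (Dec; ¬_; ¬?; yes; no)
open import Relation.Nullary.Decidable using (map′; _×-dec_; _→-dec_)
open import Algebra.Properties.Semiring.Sum +-*-semiring using (sum-syntax; sum⁺-syntax)

-- Permutations of Fin n are given in one-line notation: π is a word
-- π₀ π₁ … πₙ₋₁ without repeated letters (values and positions start at 0).

Word : ℕ → Set
Word n = Vec (Fin n) n

IsPermutation : ∀ {n} → Word n → Set
IsPermutation π = Unique π

Inversion : ∀ {n} → Word n → Fin n × Fin n → Set
Inversion π (i , j) = i < j × lookup π i > lookup π j

inversion? : ∀ {n} (π : Word n) ij → Dec (Inversion π ij)
inversion? π (i , j) = (i <? j) ×-dec (lookup π j <? lookup π i)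

inv : ∀ {n} → Word n → ℕ
inv {n} π = length (filter (inversion? π) (cartesianProduct (allFin n) (allFin n)))

-- The vector p lists the positions in π of the letters of a subsequence;
-- the second component says that this subsequence is order-isomorphic to q.

Occurrence : ∀ {m n} → Word m → Word n → Vec (Fin n) m → Set
Occurrence q π p =
  (∀ i j → i < j → lookup p i < lookup p j) ×
  (∀ i j → lookup q i < lookup q j ⇔ lookup π (lookup p i) < lookup π (lookup p j))

Contains : ∀ {m n} → Word n → Word m → Set
Contains π q = ∃[ p ] Occurrence q π p

Pattern : Set
Pattern = Σ ℕ Word

Avoids : ∀ {n} → Word n → Pattern → Set
Avoids π (_ , q) = ¬ Contains π q

AvoidsAll : ∀ {n} → List Pattern → Word n → Set
AvoidsAll B π = All (Avoids π) B

allVecs : ∀ n m → List (Vec (Fin n) m)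
allVecs n zero    = [] ∷ []
allVecs n (suc m) = cartesianProductWith _∷_ (allFin n) (allVecs n m)

∈-allVecs : ∀ {n m} (v : Vec (Fin n) m) → v ∈ allVecs n m
∈-allVecs []      = here refl
∈-allVecs (x ∷ v) = ∈-cartesianProductWith⁺ _∷_ (∈-allFin x) (∈-allVecs v)

_⇔-dec_ : {P Q : Set} → Dec P → Dec Q → Dec (P ⇔ Q)
p? ⇔-dec q? = map′ (uncurry mk⇔) (λ e → Equivalence.to e , Equivalence.from e)
                   ((p? →-dec q?) ×-dec (q? →-dec p?))

occurrence? : ∀ {m n} (q : Word m) (π : Word n) p → Dec (Occurrence q π p)
occurrence? q π p =
  all? (λ i → all? λ j → (i <? j) →-dec (lookup p i <? lookup p j)) ×-dec
  all? (λ i → all? λ j → (lookup q i <? lookup q j) ⇔-dec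
                         (lookup π (lookup p i) <? lookup π (lookup p j)))

contains? : ∀ {m n} (π : Word n) (q : Word m) → Dec (Contains π q)
contains? {m} {n} π q =
  map′ Any.satisfied (λ (p , occ) → lose (∈-allVecs p) occ)
       (Any.any? (occurrence? q π) (allVecs n m))

Counted : ∀ {n} → List Pattern → ℕ → Word n → Set
Counted B k π = IsPermutation π × inv π ≡ k × AvoidsAll B π

counted? : ∀ {n} B k (π : Word n) → Dec (Counted B k π)
counted? B k π =
  allPairs? (λ x y → ¬? (x ≟ y)) π ×-dec
  (inv π ℕₚ.≟ k) ×-dec
  All.all? (λ (_ , q) → ¬? (contains? π q)) B

av : List Pattern → ℕ → ℕ → ℕ
av B n k = length (filter (counted? B k) (allVecs n n))

p1324 p4231 : Pattern
p1324 = 4 , # 0 ∷ # 2 ∷ # 1 ∷ # 3 ∷ []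
p4231 = 4 , # 3 ∷ # 1 ∷ # 2 ∷ # 0 ∷ []

-- Formal power series, as coefficient sequences.

PowerSeries : Set
PowerSeries = ℕ → ℕ

infixl 6 _⊕_
infixl 7 _⊗_

_⊕_ : PowerSeries → PowerSeries → PowerSeries
(f ⊕ g) k = f k + g k

_⊗_ : PowerSeries → PowerSeries → PowerSeries
(f ⊗ g) k = ∑[ i ≤ k ] (f (toℕ i) * g (k ∸ toℕ i))

x^_ : ℕ → PowerSeries
(x^ m) k with m ℕₚ.≟ k
... | yes _ = 1
... | no  _ = 0

𝟙 : PowerSeries
𝟙 = x^ 0

-- ∏≤ n f is the product of f i over 1 ≤ i ≤ n.

∏≤ : ℕ → (ℕ → PowerSeries) → PowerSeries
∏≤ zero    f = 𝟙
∏≤ (suc n) f = ∏≤ n f ⊗ f (suc n)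

∑<< : ℕ → ℕ → (ℕ → ℕ → PowerSeries) → PowerSeries
∑<< M N f k = ∑[ a < M ] ∑[ b < N ] f (toℕ a) (toℕ b) k

-- Infinite products and sums are limits of the finite ones in the usual
-- topology on formal power series: each coefficient is eventually constant.

HasProduct : (ℕ → PowerSeries) → PowerSeries → Set
HasProduct f P = ∀ k → ∃[ n₀ ] (∀ n → n ℕ.≥ n₀ → ∏≤ n f k ≡ P k)

HasDoubleSum : (ℕ → ℕ → PowerSeries) → PowerSeries → Set
HasDoubleSum f S =
  ∀ k → ∃[ n₀ ] (∀ M N → M ℕ.≥ n₀ → N ℕ.≥ n₀ → ∑<< M N f k ≡ S k)

-- "The limit sequence of B exists and its generating function is C".

IsLimitGF : List Pattern → PowerSeries → Set
IsLimitGF B C = ∀ k → ∃[ mₖ ] (∀ n → n ℕ.≥ mₖ → av B n k ≡ C k)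

1+x^ : ℕ → PowerSeries
1+x^ i = 𝟙 ⊕ x^ i

summand : ℕ → ℕ → PowerSeries
summand a b = x^ ((a + 2) * (b + 1)) ⊗ ∏≤ a 1+x^ ⊗ ∏≤ b 1+x^

{-# OPTIONS --safe #-}

-- If π has length m + n and k < m, n inversions, and some letter crosses the cut
-- at m, say i < m ≤ j with π_j < m ≤ π_i, then either some a < i has π_a < π_j and
-- some d > j has π_d > π_i, which is a 1324, or there are at least m or n inversions.
-- So a 1324-avoider with k inversions is a direct sum σ ⊞ τ of words of lengths m
-- and n; it avoids both patterns iff σ avoids {132, 4231} and τ avoids {213, 4231}.
-- Reverse complement exchanges the two conditions, whence the square.
--
-- Avoiding 132 means that the Lehmer code is weakly decreasing, i.e. a partition of
-- the number of inversions.  Such a permutation avoids 4231 iff no two consecutive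
-- parts that differ by at least 2 come before two equal (positive) parts.  If all
-- parts are distinct, these are counted by ∏ (1 + x^i).  Otherwise let the last
-- equality be between the rows a + 1 and a + 2, both of length b + 1: below them are
-- distinct parts ≤ b, and the rest consists of distinct columns of height ≤ a.

module Submission where

open import Defs
open import Data.Bool using (Bool; true; false)
open import Data.Empty using (⊥)
open import Data.Fin as Fin using (Fin; zero; suc; toℕ; punchIn; punchOut; opposite; _↑ˡ_; _↑ʳ_)
open import Data.Fin.Patterns using (0F; 1F; 2F; 3F)
import Data.Fin.Properties as Finₚ
open import Data.List as List using (List; []; _∷_; length)
open import Data.List.Membership.Propositional using (_∈_)
import Data.List.Membership.Propositional.Properties as ∈ₚ
import Data.List.Properties as Listₚ
open import Data.List.Relation.Unary.All as All using (All; []; _∷_)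
import Data.List.Relation.Unary.All.Properties as Allₚ
open import Data.List.Relation.Unary.AllPairs using ([]; _∷_)
open import Data.List.Relation.Unary.Any using (here; there)
open import Data.List.Relation.Unary.Unique.Propositional using (Unique)
import Data.List.Relation.Unary.Unique.Propositional.Properties as Uniqueₚ
open import Data.Nat using (ℕ; zero; suc; _+_; _*_; _∸_; _≤_; _<_; z≤n; s≤s)
open import Data.Nat.ListAction using () renaming (sum to sumₗ)
import Data.Nat.Properties as ℕₚ
open import Algebra.Properties.Semiring.Sum ℕₚ.+-*-semiring using (sum; sum-cong-≗)
open import Data.Nat.Tactic.RingSolver using (solve-∀)
open import Data.Product using (Σ; ∃-syntax; _×_; _,_; proj₁; proj₂)
open import Data.Sum using (_⊎_; inj₁; inj₂; [_,_]′)
open import Data.Unit using (⊤; tt)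
open import Data.Vec as Vec using (Vec; []; _∷_; _∷ʳ_; lookup; tabulate)
import Data.Vec.Properties as Vecₚ
import Data.Vec.Relation.Unary.Unique.Propositional.Properties as VecUniqueₚ
open import Function using (_∘_; id; Equivalence; mk⇔)
open import Function.Definitions using (Injective)
open import Relation.Binary using (tri<; tri≈; tri>)
open import Relation.Binary.PropositionalEquality
open import Relation.Nullary using (¬_; yes; no; contradiction)
open import Relation.Nullary.Decidable using (_×-dec_)
open import Relation.Unary using (Decidable)

-- Enumerations and generating functions

-- Only the elements are listed, not the proofs of `P`, so each element counts once however many
-- proofs it has.
record Enumeration {A : Set} (P : A → Set) (n : ℕ) : Set where
  field
    elements : List A
    unique   : Unique elements
    sound    : ∀ {x} → x ∈ elements → P x
    complete : ∀ {x} → P x → x ∈ elements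
    size     : length elements ≡ n

open Enumeration

-- Induction on `xs`: the occurrence of `x` in `ys` is deleted, and the remaining elements survive
-- the deletion because they differ from `x`.
length-⊆ : {A : Set} {xs ys : List A} → Unique xs → (∀ {x} → x ∈ xs → x ∈ ys) → length xs ≤ length ys
length-⊆ {xs = []} _ _ = z≤n
length-⊆ {xs = x ∷ xs} (x∉xs ∷ u) xs⊆ys with ∈ₚ.∈-∃++ (xs⊆ys (here refl))
... | as , bs , refl = begin
  suc (length xs)              ≤⟨ s≤s (length-⊆ u sub) ⟩
  suc (length (as List.++ bs)) ≡⟨ cong suc (Listₚ.length-++ as) ⟩
  suc (length as + length bs)  ≡⟨ sym (ℕₚ.+-suc (length as) (length bs)) ⟩
  length as + suc (length bs)  ≡⟨ sym (Listₚ.length-++ as) ⟩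
  length (as List.++ x ∷ bs)   ∎
  where
  open ℕₚ.≤-Reasoning
  sub : ∀ {y} → y ∈ xs → y ∈ as List.++ bs
  sub {y} y∈xs with ∈ₚ.∈-++⁻ as (xs⊆ys (there y∈xs))
  ... | inj₁ y∈as         = ∈ₚ.∈-++⁺ˡ y∈as
  ... | inj₂ (here refl)  = contradiction refl (All.lookup x∉xs y∈xs)
  ... | inj₂ (there y∈bs) = ∈ₚ.∈-++⁺ʳ as y∈bs

module _ {A B : Set} where

  -- Injectivity is asked on the members of `xs` only: maps such as `decode` are injective just
  -- where the enumerated predicate holds.
  unique-map : (f : A → B) {xs : List A} →
    (∀ {x y} → x ∈ xs → y ∈ xs → f x ≡ f y → x ≡ y) → Unique xs → Unique (List.map f xs)
  unique-map f inj []         = []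
  unique-map f inj (x∉xs ∷ u) =
    Allₚ.map⁺ (All.tabulate λ y∈xs fx≡fy → All.lookup x∉xs y∈xs (inj (here refl) (there y∈xs) fx≡fy))
    ∷ unique-map f (λ p q → inj (there p) (there q)) u

  enum-≤ : {P : A → Set} {Q : B → Set} {m n : ℕ} (f : A → B) →
    (∀ {x y} → P x → P y → f x ≡ f y → x ≡ y) → (∀ {x} → P x → Q (f x)) →
    Enumeration P m → Enumeration Q n → m ≤ n
  enum-≤ f inj to E F = subst₂ _≤_ (trans (Listₚ.length-map f (elements E)) (size E)) (size F)
    (length-⊆ (unique-map f (λ p q → inj (sound E p) (sound E q)) (unique E))
              (λ y∈ → let _ , x∈ , y≡ = ∈ₚ.∈-map⁻ f y∈ in
                      subst (_∈ elements F) (sym y≡) (complete F (to (sound E x∈)))))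

  enum-map : {P : A → Set} {Q : B → Set} {n : ℕ} (f : A → B) →
    (∀ {x y} → P x → P y → f x ≡ f y → x ≡ y) → (∀ {x} → P x → Q (f x)) →
    (∀ {y} → Q y → ∃[ x ] P x × f x ≡ y) → Enumeration P n → Enumeration Q n
  enum-map {P} {Q} f inj to from E = record
    { elements = List.map f (elements E)
    ; unique   = unique-map f (λ p q → inj (sound E p) (sound E q)) (unique E)
    ; sound    = λ y∈ → let x , x∈ , y≡ = ∈ₚ.∈-map⁻ f y∈ in subst Q (sym y≡) (to (sound E x∈))
    ; complete = λ q → let x , p , eq = from q in subst (_∈ _) eq (∈ₚ.∈-map⁺ f (complete E p))
    ; size     = trans (Listₚ.length-map f (elements E)) (size E)
    }

  enum-⊎ : {P : A → Set} {Q : B → Set} {m n : ℕ} →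
    Enumeration P m → Enumeration Q n → Enumeration [ P , Q ]′ (m + n)
  enum-⊎ {P} {Q} E F = record
    { elements = List.map inj₁ (elements E) List.++ List.map inj₂ (elements F)
    ; unique   = Uniqueₚ.++⁺ (Uniqueₚ.map⁺ (λ { refl → refl }) (unique E))
                             (Uniqueₚ.map⁺ (λ { refl → refl }) (unique F)) disjoint
    ; sound    = sound′
    ; complete = complete′
    ; size     = trans (Listₚ.length-++ (List.map inj₁ (elements E)))
                       (cong₂ _+_ (trans (Listₚ.length-map inj₁ (elements E)) (size E))
                                  (trans (Listₚ.length-map inj₂ (elements F)) (size F)))
    }
    where
    disjoint : ∀ {z} → ¬ (z ∈ List.map inj₁ (elements E) × z ∈ List.map inj₂ (elements F))
    disjoint (z∈₁ , z∈₂) with ∈ₚ.∈-map⁻ inj₁ z∈₁ | ∈ₚ.∈-map⁻ inj₂ z∈₂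
    ... | _ , _ , refl | _ , _ , ()
    sound′ : ∀ {z} → z ∈ List.map inj₁ (elements E) List.++ List.map inj₂ (elements F) → [ P , Q ]′ z
    sound′ z∈ with ∈ₚ.∈-++⁻ (List.map inj₁ (elements E)) z∈
    ... | inj₁ z∈₁ with x , x∈ , refl ← ∈ₚ.∈-map⁻ inj₁ z∈₁ = sound E x∈
    ... | inj₂ z∈₂ with y , y∈ , refl ← ∈ₚ.∈-map⁻ inj₂ z∈₂ = sound F y∈
    complete′ : ∀ {z} → [ P , Q ]′ z → z ∈ List.map inj₁ (elements E) List.++ List.map inj₂ (elements F)
    complete′ {inj₁ x} p = ∈ₚ.∈-++⁺ˡ (∈ₚ.∈-map⁺ inj₁ (complete E p))
    complete′ {inj₂ y} q = ∈ₚ.∈-++⁺ʳ (List.map inj₁ (elements E)) (∈ₚ.∈-map⁺ inj₂ (complete F q))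

  length-cartesianProduct : ∀ (xs : List A) (ys : List B) →
    length (List.cartesianProduct xs ys) ≡ length xs * length ys
  length-cartesianProduct []       ys = refl
  length-cartesianProduct (x ∷ xs) ys = trans (Listₚ.length-++ (List.map (x ,_) ys))
    (cong₂ _+_ (Listₚ.length-map (x ,_) ys) (length-cartesianProduct xs ys))

  enum-× : {P : A → Set} {Q : B → Set} {m n : ℕ} →
    Enumeration P m → Enumeration Q n → Enumeration {A × B} (λ (x , y) → P x × Q y) (m * n)
  enum-× E F = record
    { elements = List.cartesianProduct (elements E) (elements F)
    ; unique   = Uniqueₚ.cartesianProduct⁺ (unique E) (unique F)
    ; sound    = λ z∈ → let x∈ , y∈ = ∈ₚ.∈-cartesianProduct⁻ (elements E) (elements F) z∈ in
                        sound E x∈ , sound F y∈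
    ; complete = λ (p , q) → ∈ₚ.∈-cartesianProduct⁺ (complete E p) (complete F q)
    ; size     = trans (length-cartesianProduct (elements E) (elements F)) (cong₂ _*_ (size E) (size F))
    }

enum-empty : {A : Set} {P : A → Set} → (∀ {x} → ¬ P x) → Enumeration P 0
enum-empty ¬P = record
  { elements = [] ; unique = [] ; sound = λ () ; complete = λ p → contradiction p ¬P ; size = refl }

enum-singleton : {A : Set} {P : A → Set} (a : A) → P a → (∀ {x} → P x → x ≡ a) → Enumeration P 1
enum-singleton {P = P} a p only = record
  { elements = a ∷ [] ; unique = [] ∷ [] ; sound = λ { (here refl) → p }
  ; complete = λ q → here (only q) ; size = refl }

enum-resp : {A : Set} {P Q : A → Set} {n : ℕ} →
  (∀ {x} → P x → Q x) → (∀ {x} → Q x → P x) → Enumeration P n → Enumeration Q n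
enum-resp to from = enum-map id (λ _ _ eq → eq) to (λ q → _ , from q , refl)

-- Double counting: identities between numbers are obtained below by enumerating one predicate in
-- two ways.
enum-unique : {A : Set} {P : A → Set} {m n : ℕ} → Enumeration P m → Enumeration P n → m ≡ n
enum-unique E F = ℕₚ.≤-antisym (enum-≤ id (λ _ _ eq → eq) id E F)
                               (enum-≤ id (λ _ _ eq → eq) id F E)

enum-Σ : ∀ {n} {A : Fin n → Set} {P : ∀ i → A i → Set} {f : Fin n → ℕ} →
  (∀ i → Enumeration (P i) (f i)) → Enumeration {Σ (Fin n) A} (λ (i , x) → P i x) (sum f)
enum-Σ {zero}          _ = enum-empty λ { {() , _} }
enum-Σ {suc n} {A} {P} E =
  enum-map merge inj (λ { {inj₁ _} p → p ; {inj₂ _} p → p }) split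
    (enum-⊎ {P = P zero} (E zero) (enum-Σ (E ∘ suc)))
  where
  merge : A zero ⊎ Σ (Fin n) (A ∘ suc) → Σ (Fin (suc n)) A
  merge (inj₁ x)       = zero , x
  merge (inj₂ (i , x)) = suc i , x
  R = [ P zero , (λ (i , x) → P (suc i) x) ]′
  inj : ∀ {s t} → R s → R t → merge s ≡ merge t → s ≡ t
  inj {inj₁ _} {inj₁ _} _ _ refl = refl
  inj {inj₂ _} {inj₂ _} _ _ refl = refl
  split : ∀ {s} → P (proj₁ s) (proj₂ s) → ∃[ t ] R t × merge t ≡ s
  split {zero , x}  p = inj₁ x , p , refl
  split {suc i , x} p = inj₂ (i , x) , p , refl

enum-Fin< : ∀ {n} m → m ≤ n → Enumeration {Fin n} (λ v → toℕ v < m) m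
enum-Fin< zero    _         = enum-empty λ ()
enum-Fin< {suc n} (suc m) (s≤s m≤n) =
  enum-map shift inj (λ { {inj₁ _} _ → s≤s z≤n ; {inj₂ _} p → s≤s p })
    (λ { {zero} _ → inj₁ tt , tt , refl ; {suc v} (s≤s p) → inj₂ v , p , refl })
    (enum-⊎ (enum-singleton {P = λ _ → ⊤} tt tt (λ _ → refl)) (enum-Fin< m m≤n))
  where
  shift : ⊤ ⊎ Fin n → Fin (suc n)
  shift (inj₁ _) = zero
  shift (inj₂ v) = suc v
  R = [ (λ _ → ⊤) , (λ v → toℕ v < m) ]′
  inj : ∀ {s t} → R s → R t → shift s ≡ shift t → s ≡ t
  inj {inj₁ _} {inj₁ _} _ _ refl = refl
  inj {inj₂ _} {inj₂ _} _ _ refl = refl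

-- A combinatorial class: `f` is the ordinary generating function of `A` with respect to the weight
-- `w`.
record Class {A : Set} (w : A → ℕ) (f : PowerSeries) : Set where
  constructor class
  field weighing : ∀ k → Enumeration (λ x → w x ≡ k) (f k)

open Class

class-x^ : ∀ m → Class {⊤} (λ _ → m) (x^ m)
class-x^ m .weighing k with m ℕₚ.≟ k
... | yes m≡k = enum-singleton tt m≡k (λ _ → refl)
... | no  m≢k = enum-empty m≢k

module _ {A B : Set} {w : A → ℕ} {v : B → ℕ} {f g : PowerSeries} where

  class-⊕ : Class w f → Class v g → Class [ w , v ]′ (f ⊕ g)
  class-⊕ C D .weighing k = enum-resp (λ { {inj₁ _} p → p ; {inj₂ _} p → p })
                            (λ { {inj₁ _} p → p ; {inj₂ _} p → p }) (enum-⊎ (weighing C k) (weighing D k))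

  -- The index of the convolution sum is the weight of the first component, so forgetting it is
  -- injective. The predicates `P` and `Q` allow pairs of good partitions as well as whole classes.
  enum-convolution : {P : A → Set} {Q : B → Set} →
    (∀ k → Enumeration (λ x → P x × w x ≡ k) (f k)) →
    (∀ k → Enumeration (λ y → Q y × v y ≡ k) (g k)) →
    ∀ k → Enumeration {A × B} (λ (x , y) → (P x × Q y) × w x + v y ≡ k) ((f ⊗ g) k)
  enum-convolution {P} {Q} E F k = enum-map {P = R} proj₂ inj
    (λ {(i , x , y)} ((p , wx) , (q , vy)) →
       (p , q) , trans (cong₂ _+_ wx vy) (ℕₚ.m+[n∸m]≡n (ℕₚ.<⇒≤pred (Finₚ.toℕ<n i))))
    (λ {(x , y)} ((p , q) , eq) → let x<k = s≤s (ℕₚ.m+n≤o⇒m≤o (w x) (ℕₚ.≤-reflexive eq)) in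
       (Fin.fromℕ< x<k , x , y) ,
       ((p , sym (Finₚ.toℕ-fromℕ< x<k)) ,
        (q , trans (sym (ℕₚ.m+n∸m≡n (w x) (v y)))
                   (cong₂ _∸_ eq (sym (Finₚ.toℕ-fromℕ< x<k))))) , refl)
    (enum-Σ {n = suc k} (λ i → enum-× (E (toℕ i)) (F (k ∸ toℕ i))))
    where
    R : Fin (suc k) × A × B → Set
    R (i , x , y) = (P x × w x ≡ toℕ i) × (Q y × v y ≡ k ∸ toℕ i)
    inj : ∀ {s t} → R s → R t → proj₂ s ≡ proj₂ t → s ≡ t
    inj ((_ , p) , _) ((_ , q) , _) refl with refl ← Finₚ.toℕ-injective (trans (sym p) q) = refl

  class-⊗ : Class w f → Class v g → Class {A × B} (λ (x , y) → w x + v y) (f ⊗ g)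
  class-⊗ C D .weighing k = enum-resp proj₂ (_ ,_)
    (enum-convolution {P = λ _ → ⊤} {Q = λ _ → ⊤}
      (λ k → enum-resp (_ ,_) proj₂ (weighing C k)) (λ k → enum-resp (_ ,_) proj₂ (weighing D k)) k)

module _ {A B : Set} {w : A → ℕ} {v : B → ℕ} {f : PowerSeries} where

  class-bijection : (h : A → B) (h⁻¹ : B → A) → (∀ x → h⁻¹ (h x) ≡ x) → (∀ y → h (h⁻¹ y) ≡ y) →
    (∀ x → v (h x) ≡ w x) → Class w f → Class v f
  class-bijection h h⁻¹ left right weight C .weighing k = enum-map h
    (λ {x} {y} _ _ eq → trans (sym (left x)) (trans (cong h⁻¹ eq) (left y)))
    (λ {x} p → trans (weight x) p)
    (λ {y} q → h⁻¹ y , trans (sym (weight (h⁻¹ y))) (trans (cong v (right y)) q) , right y) (weighing C k)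

class-Σ : ∀ {n} {A : Fin n → Set} {w : ∀ i → A i → ℕ} {f : Fin n → PowerSeries} →
  (∀ i → Class (w i) (f i)) → Class {Σ (Fin n) A} (λ (i , x) → w i x) (λ k → sum (λ i → f i k))
class-Σ C .weighing k = enum-Σ (λ i → weighing (C i) k)

-- Classes counted by the products and the summands

-- A vector encodes a subset of {1, ..., n}, that is, a partition into distinct parts at most n; the
-- head stands for the largest candidate n.
bitWeight : ∀ {n} → Vec Bool n → ℕ
bitWeight []                  = 0
bitWeight {suc n} (true ∷ v)  = bitWeight v + suc n
bitWeight {suc n} (false ∷ v) = bitWeight v

class-bits : ∀ n → Class (bitWeight {n}) (∏≤ n 1+x^)
class-bits zero    = class-bijection (λ _ → []) (λ _ → tt) (λ _ → refl) (λ { [] → refl })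
                                     (λ _ → refl) (class-x^ 0)
class-bits (suc n) = class-bijection
  (λ { (v , inj₁ _) → false ∷ v ; (v , inj₂ _) → true ∷ v })
  (λ { (false ∷ v) → v , inj₁ tt ; (true ∷ v) → v , inj₂ tt })
  (λ { (v , inj₁ _) → refl ; (v , inj₂ _) → refl })
  (λ { (false ∷ v) → refl ; (true ∷ v) → refl })
  (λ { (v , inj₁ _) → sym (ℕₚ.+-identityʳ _) ; (v , inj₂ _) → refl })
  (class-⊗ (class-bits n) (class-⊕ (class-x^ 0) (class-x^ (suc n))))

-- A set of total weight `k` has no element above `k`, so every bit beyond the first `k` candidates
-- is false.
∏-stable : ∀ {n k} → k ≤ n → ∏≤ n 1+x^ k ≡ ∏≤ k 1+x^ k
∏-stable {zero}      z≤n = refl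
∏-stable {suc n} {k} k≤1+n with ℕₚ.m≤n⇒m<n∨m≡n k≤1+n
... | inj₂ refl     = refl
... | inj₁ (s≤s k≤n) = trans
  (enum-unique (weighing (class-bits (suc n)) k)
    (enum-map (false ∷_) (λ { _ _ refl → refl }) id
      (λ { {false ∷ v} eq → v , eq , refl
         ; {true ∷ v} eq → contradiction (ℕₚ.m+n≤o⇒n≤o (bitWeight v) (ℕₚ.≤-reflexive eq))
                                         (ℕₚ.<⇒≱ (s≤s k≤n)) })
      (weighing (class-bits n) k)))
  (∏-stable k≤n)

-- The size of a Young diagram cut into three: a rectangle of a + 2 rows of length b + 1, columns of
-- distinct heights at most a to its right (`e`), and rows of distinct lengths at most b below it
-- (`f`).
stairWeight : ∀ a b → Vec Bool a × Vec Bool b → ℕ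
stairWeight a b (e , f) = (a + 2) * (b + 1) + bitWeight e + bitWeight f

class-summand : ∀ a b → Class (stairWeight a b) (summand a b)
class-summand a b = class-bijection
  (λ ((_ , e) , f) → e , f) (λ (e , f) → (tt , e) , f) (λ _ → refl) (λ _ → refl) (λ _ → refl)
  (class-⊗ (class-⊗ (class-x^ ((a + 2) * (b + 1))) (class-bits a)) (class-bits b))

-- The rectangle alone has more than a and more than b cells. Hence only finitely many summands
-- reach a given degree.
stairWeight-> : ∀ a b s → a < stairWeight a b s × b < stairWeight a b s
stairWeight-> a b (e , f) =
  ℕₚ.≤-trans (ℕₚ.≤-trans (ℕₚ.m≤m+n (suc a) (a * b + 2 * b + 1)) (ℕₚ.≤-reflexive (lem₁ a b))) rest ,
  ℕₚ.≤-trans (ℕₚ.≤-trans (ℕₚ.m≤m+n (suc b) (a * b + a + b + 1)) (ℕₚ.≤-reflexive (lem₂ a b))) rest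
  where
  rest : (a + 2) * (b + 1) ≤ stairWeight a b (e , f)
  rest = ℕₚ.≤-trans (ℕₚ.m≤m+n _ (bitWeight e)) (ℕₚ.m≤m+n _ (bitWeight f))
  lem₁ : ∀ a b → suc a + (a * b + 2 * b + 1) ≡ (a + 2) * (b + 1)
  lem₁ = solve-∀
  lem₂ : ∀ a b → suc b + (a * b + a + b + 1) ≡ (a + 2) * (b + 1)
  lem₂ = solve-∀

summand-vanishes : ∀ a b k → k ≤ a ⊎ k ≤ b → summand a b k ≡ 0
summand-vanishes a b k large = enum-unique (weighing (class-summand a b) k)
  (enum-empty λ {s} eq → absurd large eq (stairWeight-> a b s))
  where
  absurd : k ≤ a ⊎ k ≤ b → ∀ {w} → w ≡ k → a < w × b < w → ⊥
  absurd (inj₁ k≤a) refl (a<k , _) = ℕₚ.<⇒≱ a<k k≤a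
  absurd (inj₂ k≤b) refl (_ , b<k) = ℕₚ.<⇒≱ b<k k≤b

sum-zero : ∀ {n} (f : Fin n → ℕ) → (∀ i → f i ≡ 0) → sum f ≡ 0
sum-zero {zero}  f f≡0 = refl
sum-zero {suc n} f f≡0 = cong₂ _+_ (f≡0 zero) (sum-zero (f ∘ suc) (f≡0 ∘ suc))

sum-stable : ∀ {k n} (f : ℕ → ℕ) → k ≤ n → (∀ i → k ≤ i → f i ≡ 0) →
  sum {n} (f ∘ toℕ) ≡ sum {k} (f ∘ toℕ)
sum-stable {n = n} f z≤n       f≡0 = sum-zero {n} (f ∘ toℕ) (λ i → f≡0 (toℕ i) z≤n)
sum-stable         f (s≤s k≤n) f≡0 = cong (f 0 +_) (sum-stable (f ∘ suc) k≤n (λ i → f≡0 (suc i) ∘ s≤s))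

∑<<-stable : ∀ {M N k} → k ≤ M → k ≤ N → ∑<< M N summand k ≡ ∑<< k k summand k
∑<<-stable {M} {N} {k} k≤M k≤N = trans
  (sum-stable (λ a → sum {N} (λ b → summand a (toℕ b) k)) k≤M
    (λ a k≤a → sum-zero {N} _ (λ b → summand-vanishes a (toℕ b) k (inj₁ k≤a))))
  (sum-cong-≗ {k} (λ a → sum-stable (λ b → summand (toℕ a) b k) k≤N
    (λ b k≤b → summand-vanishes (toℕ a) b k (inj₂ k≤b))))

-- Good partitions as distinct parts or staircases

-- The default 0 agrees with padding partitions by zeros, and in `Strict` it forces the last part to
-- be positive.
hd : List ℕ → ℕ
hd []      = 0
hd (x ∷ _) = x

data Strict : List ℕ → Set where
  []  : Strict []
  _∷_ : ∀ {x l} → hd l < x → Strict l → Strict (x ∷ l)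

-- The weakly decreasing lists of positive parts in which no two consecutive
-- parts that differ by at least 2 come before two equal parts.

data Good : List ℕ → Set where
  strict : ∀ {l} → Strict l → Good l
  same   : ∀ {y l} → Good (suc y ∷ l) → Good (suc y ∷ suc y ∷ l)
  up     : ∀ {y l} → Good (suc y ∷ l) → Good (suc (suc y) ∷ suc y ∷ l)

parts : ∀ {b} → Vec Bool b → List ℕ
parts []                  = []
parts {suc b} (true ∷ f)  = suc b ∷ parts f
parts {suc b} (false ∷ f) = parts f

hd-parts : ∀ {b} (f : Vec Bool b) → hd (parts f) ≤ b
hd-parts []          = z≤n
hd-parts (true ∷ f)  = ℕₚ.≤-refl
hd-parts (false ∷ f) = ℕₚ.m≤n⇒m≤1+n (hd-parts f)

strict-parts : ∀ {b} (f : Vec Bool b) → Strict (parts f)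
strict-parts []          = []
strict-parts (true ∷ f)  = s≤s (hd-parts f) ∷ strict-parts f
strict-parts (false ∷ f) = strict-parts f

sum-parts : ∀ {b} (f : Vec Bool b) → sumₗ (parts f) ≡ bitWeight f
sum-parts []                  = refl
sum-parts {suc b} (true ∷ f)  = trans (cong (suc b +_) (sum-parts f)) (ℕₚ.+-comm (suc b) (bitWeight f))
sum-parts (false ∷ f)         = sum-parts f

parts-injective : ∀ {b} (f g : Vec Bool b) → parts f ≡ parts g → f ≡ g
parts-injective []          []          _  = refl
parts-injective (true ∷ f)  (true ∷ g)  eq = cong (true ∷_) (parts-injective f g (Listₚ.∷-injectiveʳ eq))
parts-injective (false ∷ f) (false ∷ g) eq = cong (false ∷_) (parts-injective f g eq)
parts-injective (true ∷ f)  (false ∷ g) eq =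
  contradiction (subst (λ l → hd l ≤ _) (sym eq) (hd-parts g)) ℕₚ.1+n≰n
parts-injective (false ∷ f) (true ∷ g)  eq =
  contradiction (subst (λ l → hd l ≤ _) eq (hd-parts f)) ℕₚ.1+n≰n

parts-surjective : ∀ b {l} → Strict l → hd l ≤ b → ∃[ f ] parts {b} f ≡ l
parts-surjective zero    []        _ = [] , refl
parts-surjective zero    (l<x ∷ _) x≤0 = contradiction (ℕₚ.≤-trans l<x x≤0) λ ()
parts-surjective (suc b) {l} s hd≤1+b with ℕₚ.m≤n⇒m<n∨m≡n hd≤1+b
... | inj₁ (s≤s hd≤b) = let f , eq = parts-surjective b s hd≤b in false ∷ f , eq
parts-surjective (suc b) (l<x ∷ s) _ | inj₂ refl =
  let f , eq = parts-surjective b s (ℕₚ.<⇒≤pred l<x) in true ∷ f , cong (suc b ∷_) eq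

-- Here c starts with the part v, and the bits of e are the differences of the
-- consecutive new parts, listed from c outwards: a first bit 1 raises all new parts.

front : ∀ {a} → Vec Bool a → ℕ → List ℕ → List ℕ
front []          v c = c
front (true ∷ e)  v c = front e (suc v) (suc v ∷ c)
front (false ∷ e) v c = front e v (v ∷ c)

-- The two copies of `suc b` are the last pair of equal parts: smaller distinct parts follow them,
-- and `e` builds the a parts before them.
stairs : ∀ {a b} → Vec Bool a → Vec Bool b → List ℕ
stairs {b = b} e f = front e (suc b) (suc b ∷ suc b ∷ parts f)

-- A raise is inherited by all parts added from then on. A bit 1 thus adds a column whose height is
-- the number of parts still to come, which is its weight in `bitWeight`.
sum-front : ∀ {a} (e : Vec Bool a) v c → sumₗ (front e v c) ≡ a * v + bitWeight e + sumₗ c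
sum-front []                  v c = refl
sum-front {suc a} (true ∷ e)  v c = trans (sum-front e (suc v) (suc v ∷ c)) (lem a v (bitWeight e) (sumₗ c))
  where
  lem : ∀ a v w s → a * suc v + w + (suc v + s) ≡ suc a * v + (w + suc a) + s
  lem = solve-∀
sum-front {suc a} (false ∷ e) v c = trans (sum-front e v (v ∷ c)) (lem a v (bitWeight e) (sumₗ c))
  where
  lem : ∀ a v w s → a * v + w + (v + s) ≡ suc a * v + w + s
  lem = solve-∀

sum-stairs : ∀ {a b} (e : Vec Bool a) (f : Vec Bool b) → sumₗ (stairs e f) ≡ stairWeight a b (e , f)
sum-stairs {a} {b} e f = trans (sum-front e (suc b) _)
  (trans (cong (λ s → a * suc b + bitWeight e + (suc b + (suc b + s))) (sum-parts f))
         (lem a b (bitWeight e) (bitWeight f)))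
  where
  lem : ∀ a b w s → a * suc b + w + (suc b + (suc b + s)) ≡ (a + 2) * (b + 1) + w + s
  lem = solve-∀

good-front : ∀ {a} (e : Vec Bool a) {v c} → Good (suc v ∷ c) → Good (front e (suc v) (suc v ∷ c))
good-front []          g = g
good-front (true ∷ e)  g = good-front e (up g)
good-front (false ∷ e) g = good-front e (same g)

good-stairs : ∀ {a b} (e : Vec Bool a) (f : Vec Bool b) → Good (stairs e f)
good-stairs e f = good-front e (same (strict (s≤s (hd-parts f) ∷ strict-parts f)))

-- The bits are read from `c` outwards, so the last bit decides the outermost part. This matches
-- `same` and `up`, which add a part at the front of the list.
front-∷ʳ : ∀ {a} (e : Vec Bool a) {v c h r} → front e v (v ∷ c) ≡ h ∷ r →
  front (e ∷ʳ false) v (v ∷ c) ≡ h ∷ h ∷ r × front (e ∷ʳ true) v (v ∷ c) ≡ suc h ∷ h ∷ r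
front-∷ʳ []          refl = refl , refl
front-∷ʳ (true ∷ e)  eq   = front-∷ʳ e eq
front-∷ʳ (false ∷ e) eq   = front-∷ʳ e eq

-- Along the derivation, `up` keeps a strict list strict, the first `same` starts a staircase with a
-- = 0, and each later constructor appends one bit.
good⇒strict⊎stairs : ∀ {l} → Good l →
  Strict l ⊎ ∃[ a ] ∃[ b ] Σ (Vec Bool a) λ e → Σ (Vec Bool b) λ f → stairs e f ≡ l
good⇒strict⊎stairs (strict s) = inj₁ s
good⇒strict⊎stairs (same g) with good⇒strict⊎stairs g
... | inj₂ (_ , _ , e , f , eq) = inj₂ (_ , _ , e ∷ʳ false , f , proj₁ (front-∷ʳ e eq))
... | inj₁ (l<x ∷ s) = let f , eq = parts-surjective _ s (ℕₚ.<⇒≤pred l<x) in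
                       inj₂ (0 , _ , [] , f , cong (λ l → _ ∷ _ ∷ l) eq)
good⇒strict⊎stairs (up g) with good⇒strict⊎stairs g
... | inj₂ (_ , _ , e , f , eq) = inj₂ (_ , _ , e ∷ʳ true , f , proj₂ (front-∷ʳ e eq))
... | inj₁ s = inj₁ (ℕₚ.n<1+n _ ∷ s)

¬strict-repeat : ∀ q {v s} → ¬ Strict (q List.++ v ∷ v ∷ s)
¬strict-repeat []      (v<v ∷ _) = ℕₚ.<-irrefl refl v<v
¬strict-repeat (x ∷ q) (_ ∷ s)   = ¬strict-repeat q s

front-prefix : ∀ {a} (e : Vec Bool a) v c → ∃[ p ] length p ≡ a × front e v c ≡ p List.++ c
front-prefix []                  v c = [] , refl , refl
front-prefix {suc a} (true ∷ e)  v c with p , len , eq ← front-prefix e (suc v) (suc v ∷ c) =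
  p List.∷ʳ suc v , trans (Listₚ.length-++ p) (trans (ℕₚ.+-comm (length p) 1) (cong suc len)) ,
  trans eq (sym (Listₚ.++-assoc p (suc v ∷ []) c))
front-prefix {suc a} (false ∷ e) v c with p , len , eq ← front-prefix e v (v ∷ c) =
  p List.∷ʳ v , trans (Listₚ.length-++ p) (trans (ℕₚ.+-comm (length p) 1) (cong suc len)) ,
  trans eq (sym (Listₚ.++-assoc p (v ∷ []) c))

¬strict-stairs : ∀ {a b} (e : Vec Bool a) (f : Vec Bool b) → ¬ Strict (stairs e f)
¬strict-stairs {b = b} e f s with p , _ , eq ← front-prefix e (suc b) (suc b ∷ suc b ∷ parts f) =
  ¬strict-repeat p (subst Strict eq s)

-- Strict lists contain no repetition, so each of the two marked repetitions is the last one of the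
-- common list.
last-repeat-unique : ∀ p q {v w} {s t : List ℕ} → Strict (v ∷ s) → Strict (w ∷ t) →
  p List.++ v ∷ v ∷ s ≡ q List.++ w ∷ w ∷ t → length p ≡ length q × v ≡ w
last-repeat-unique []      []      _ _  refl = refl , refl
last-repeat-unique []      (_ ∷ q) σ _  eq   =
  contradiction (subst Strict (Listₚ.∷-injectiveʳ eq) σ) (¬strict-repeat q)
last-repeat-unique (_ ∷ p) []      _ τ  eq   =
  contradiction (subst Strict (sym (Listₚ.∷-injectiveʳ eq)) τ) (¬strict-repeat p)
last-repeat-unique (_ ∷ p) (_ ∷ q) σ τ  eq   =
  let len , v≡w = last-repeat-unique p q σ τ (Listₚ.∷-injectiveʳ eq) in cong suc len , v≡w

++-cancel-length : ∀ (p q : List ℕ) {s t} → length p ≡ length q → p List.++ s ≡ q List.++ t → s ≡ t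
++-cancel-length []      []      _   eq = eq
++-cancel-length (_ ∷ p) (_ ∷ q) len eq =
  ++-cancel-length p q (ℕₚ.suc-injective len) (Listₚ.∷-injectiveʳ eq)

front-cancel : ∀ {a} (e e′ : Vec Bool a) {v v′ c c′} → front e v c ≡ front e′ v′ c′ → c ≡ c′
front-cancel e e′ {v} {v′} {c} {c′} eq
  with p , len , eq₁ ← front-prefix e v c | q , len′ , eq₂ ← front-prefix e′ v′ c′ =
  ++-cancel-length p q (trans len (sym len′)) (trans (sym eq₁) (trans eq eq₂))

front-injective : ∀ {a} (e e′ : Vec Bool a) {v c} → front e v c ≡ front e′ v c → e ≡ e′
front-injective []          []           _  = refl
front-injective (true ∷ e)  (true ∷ e′)  eq = cong (true ∷_) (front-injective e e′ eq)
front-injective (false ∷ e) (false ∷ e′) eq = cong (false ∷_) (front-injective e e′ eq)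
front-injective (true ∷ e)  (false ∷ e′) eq =
  contradiction (Listₚ.∷-injectiveˡ (front-cancel e e′ eq)) ℕₚ.1+n≢n
front-injective (false ∷ e) (true ∷ e′)  eq =
  contradiction (sym (Listₚ.∷-injectiveˡ (front-cancel e e′ eq))) ℕₚ.1+n≢n

-- The position of the last repetition determines a, and its value determines b.
stairs-sizes : ∀ {a a′ b b′} (e : Vec Bool a) (e′ : Vec Bool a′) (f : Vec Bool b) (f′ : Vec Bool b′) →
  stairs e f ≡ stairs e′ f′ → a ≡ a′ × b ≡ b′
stairs-sizes {b = b} {b′} e e′ f f′ eq
  with p , len , eq₁ ← front-prefix e (suc b) (suc b ∷ suc b ∷ parts f)
     | q , len′ , eq₂ ← front-prefix e′ (suc b′) (suc b′ ∷ suc b′ ∷ parts f′)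
  with len″ , b≡b′ ← last-repeat-unique p q
         (s≤s (hd-parts f) ∷ strict-parts f) (s≤s (hd-parts f′) ∷ strict-parts f′)
         (trans (sym eq₁) (trans eq eq₂)) =
  trans (sym len) (trans len″ len′) , ℕₚ.suc-injective b≡b′

stairs-injective : ∀ {a b} (e e′ : Vec Bool a) (f f′ : Vec Bool b) →
  stairs e f ≡ stairs e′ f′ → e ≡ e′ × f ≡ f′
stairs-injective e e′ f f′ eq
  with refl ← parts-injective f f′ (Listₚ.∷-injectiveʳ (Listₚ.∷-injectiveʳ (front-cancel e e′ eq))) =
  front-injective e e′ eq , refl

-- Counting good partitions

-- The bounds by `k` make the type finite and lose no good partition of `k`: its parts are at most
-- `k`, and a staircase of size `k` has a and b below `k`.
Shape : ℕ → Set
Shape k = Vec Bool k ⊎ Σ (Fin k) λ a → Σ (Fin k) λ b → Vec Bool (toℕ a) × Vec Bool (toℕ b)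

shapeWeight : ∀ k → Shape k → ℕ
shapeWeight k = [ bitWeight , (λ (a , b , s) → stairWeight (toℕ a) (toℕ b) s) ]′

class-shape : ∀ k → Class (shapeWeight k) (∏≤ k 1+x^ ⊕ ∑<< k k summand)
class-shape k = class-⊕ (class-bits k) (class-Σ λ a → class-Σ λ b → class-summand (toℕ a) (toℕ b))

partition : ∀ {k} → Shape k → List ℕ
partition (inj₁ f)               = parts f
partition (inj₂ (_ , _ , e , f)) = stairs e f

good-partition : ∀ {k} (s : Shape k) → Good (partition s)
good-partition (inj₁ f)               = strict (strict-parts f)
good-partition (inj₂ (_ , _ , e , f)) = good-stairs e f

sum-partition : ∀ {k} (s : Shape k) → sumₗ (partition s) ≡ shapeWeight k s
sum-partition (inj₁ f)               = sum-parts f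
sum-partition (inj₂ (_ , _ , e , f)) = sum-stairs e f

partition-injective : ∀ {k} (s t : Shape k) → partition s ≡ partition t → s ≡ t
partition-injective (inj₁ f) (inj₁ g) eq = cong inj₁ (parts-injective f g eq)
partition-injective (inj₁ f) (inj₂ (_ , _ , e , g)) eq =
  contradiction (subst Strict eq (strict-parts f)) (¬strict-stairs e g)
partition-injective (inj₂ (_ , _ , e , g)) (inj₁ f) eq =
  contradiction (subst Strict (sym eq) (strict-parts f)) (¬strict-stairs e g)
partition-injective (inj₂ (a , b , e , f)) (inj₂ (a′ , b′ , e′ , f′)) eq
  with a≡a′ , b≡b′ ← stairs-sizes e e′ f f′ eq
  with refl ← Finₚ.toℕ-injective {i = a} {a′} a≡a′ | refl ← Finₚ.toℕ-injective {i = b} {b′} b≡b′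
  with refl , refl ← stairs-injective e e′ f f′ eq = refl

hd≤sum : ∀ l → hd l ≤ sumₗ l
hd≤sum []      = z≤n
hd≤sum (x ∷ l) = ℕₚ.m≤m+n x (sumₗ l)

stairs-shape : ∀ {k a b} (e : Vec Bool a) (f : Vec Bool b) → a < k → b < k →
  ∃[ s ] partition {k} s ≡ stairs e f
stairs-shape e f a<k b<k
  -- Matching the two equations turns a and b into `toℕ i` and `toℕ j`, so that `e` and `f` acquire
  -- the types that `Shape` asks for.
  with Fin.fromℕ< a<k | Finₚ.toℕ-fromℕ< a<k | Fin.fromℕ< b<k | Finₚ.toℕ-fromℕ< b<k
... | i | refl | j | refl = inj₂ (i , j , e , f) , refl

partition-surjective : ∀ {l} → Good l → ∃[ s ] partition {sumₗ l} s ≡ l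
partition-surjective {l} g with good⇒strict⊎stairs g
... | inj₁ s = let f , eq = parts-surjective (sumₗ l) s (hd≤sum l) in inj₁ f , eq
... | inj₂ (a , b , e , f , refl) =
  let a< , b< = stairWeight-> a b (e , f)
      weight≡ = sym (sum-stairs e f)
  in stairs-shape e f (subst (a <_) weight≡ a<) (subst (b <_) weight≡ b<)

-- The diagonals of the partial products and sums: the coefficient of degree k no longer changes
-- from the k-th stage on.
P∞ S∞ : PowerSeries
P∞ k = ∏≤ k 1+x^ k
S∞ k = ∑<< k k summand k

enum-good : ∀ k → Enumeration (λ l → Good l × sumₗ l ≡ k) ((P∞ ⊕ S∞) k)
enum-good k = enum-map partition (λ {s} {t} _ _ → partition-injective s t)
  (λ {s} eq → good-partition s , trans (sum-partition s) eq)
  (λ { (g , refl) → let s , eq = partition-surjective g in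
       s , trans (sym (sum-partition s)) (cong sumₗ eq) , eq })
  (weighing (class-shape k) k)

-- Permutations and inversions

val : ∀ {n} → Word n → Fin n → ℕ
val π i = toℕ (lookup π i)

Perm : ∀ {n} → Word n → Set
Perm π = ∀ {i j} → lookup π i ≡ lookup π j → i ≡ j

isPermutation⇒perm : ∀ {n} {π : Word n} → IsPermutation π → Perm π
isPermutation⇒perm u = VecUniqueₚ.lookup-injective u _ _

perm⇒isPermutation : ∀ {n} {π : Word n} → Perm π → IsPermutation π
perm⇒isPermutation {π = π} p = subst IsPermutation (Vecₚ.tabulate∘lookup π) (VecUniqueₚ.tabulate⁺ p)

val-injective : ∀ {n} {π : Word n} → Perm π → ∀ {i j} → val π i ≡ val π j → i ≡ j
val-injective p eq = p (Finₚ.toℕ-injective eq)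

-- If `y` were missed, punching it out would inject `Fin (suc n)` into `Fin n`.
injective⇒surjective : ∀ {n} (f : Fin n → Fin n) → Injective _≡_ _≡_ f → ∀ y → ∃[ x ] f x ≡ y
injective⇒surjective {suc n} f inj y with Finₚ.any? (λ x → f x Finₚ.≟ y)
... | yes ∃x = ∃x
... | no ∄x  = contradiction
  (Finₚ.injective⇒≤ {f = λ x → punchOut (λ y≡fx → ∄x (x , sym y≡fx))}
                    (λ eq → inj (Finₚ.punchOut-injective {i = y} _ _ eq)))
  ℕₚ.1+n≰n

position : ∀ {n} (π : Word n) → Perm π → ∀ v → v < n → ∃[ i ] val π i ≡ v
position π p v v<n =
  let i , eq = injective⇒surjective (lookup π) p (Fin.fromℕ< v<n) in
  i , trans (cong toℕ eq) (Finₚ.toℕ-fromℕ< v<n)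

lookup-ext : ∀ {n} {A : Set} {v w : Vec A n} → (∀ i → lookup v i ≡ lookup w i) → v ≡ w
lookup-ext {v = v} {w} eq =
  trans (sym (Vecₚ.tabulate∘lookup v)) (trans (Vecₚ.tabulate-cong eq) (Vecₚ.tabulate∘lookup w))

enum-filter : {A : Set} {P : A → Set} (P? : Decidable P) (xs : List A) → Unique xs → (∀ x → x ∈ xs) →
  Enumeration P (length (List.filter P? xs))
enum-filter P? xs u all = record
  { elements = List.filter P? xs
  ; unique   = Uniqueₚ.filter⁺ P? u
  ; sound    = λ x∈ → proj₂ (∈ₚ.∈-filter⁻ P? {xs = xs} x∈)
  ; complete = λ p → ∈ₚ.∈-filter⁺ P? (all _) p
  ; size     = refl
  }

enum-inv : ∀ {n} (π : Word n) → Enumeration (Inversion π) (inv π)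
enum-inv {n} π = enum-filter (inversion? π) _
  (Uniqueₚ.cartesianProduct⁺ (Uniqueₚ.allFin⁺ n) (Uniqueₚ.allFin⁺ n))
  (λ (i , j) → ∈ₚ.∈-cartesianProduct⁺ (∈ₚ.∈-allFin i) (∈ₚ.∈-allFin j))

unique-allVecs : ∀ n m → Unique (allVecs n m)
unique-allVecs n zero    = Uniqueₚ.tabulate⁺ {n = 1} {f = λ _ → []} λ { {zero} {zero} _ → refl }
unique-allVecs n (suc m) = Uniqueₚ.cartesianProductWith⁺ Vec._∷_ Vecₚ.∷-injective
  (Uniqueₚ.allFin⁺ n) (unique-allVecs n m)

enum-av : ∀ B n k → Enumeration (Counted B k) (av B n k)
enum-av B n k = enum-filter (counted? B k) (allVecs n n) (unique-allVecs n n) ∈-allVecs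

-- Patterns

module _ {n} (π : Word n) where

  Has132 Has213 Has1324 Has4231 : Set
  Has132  = ∃[ a ] ∃[ b ] ∃[ c ] a Fin.< b × b Fin.< c × val π a < val π c × val π c < val π b
  Has213  = ∃[ a ] ∃[ b ] ∃[ c ] a Fin.< b × b Fin.< c × val π b < val π a × val π a < val π c
  Has1324 = ∃[ a ] ∃[ b ] ∃[ c ] ∃[ d ] (a Fin.< b × b Fin.< c × c Fin.< d) ×
            (val π a < val π c × val π c < val π b × val π b < val π d)
  Has4231 = ∃[ a ] ∃[ b ] ∃[ c ] ∃[ d ] (a Fin.< b × b Fin.< c × c Fin.< d) ×
            (val π d < val π b × val π b < val π c × val π c < val π a)

  -- What has to follow a first letter `t` for that letter to be the 4 of a 4231.
  Has231Below : ℕ → Set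
  Has231Below t = ∃[ a ] ∃[ b ] ∃[ c ] (a Fin.< b × b Fin.< c) ×
                  (val π c < val π a × val π a < val π b × val π b < t)

Increasing : ∀ {m} → (Fin m → ℕ) → Set
Increasing f = ∀ i j → i Fin.< j → f i < f j

increasing₄ : (f : Fin 4 → ℕ) → f 0F < f 1F → f 1F < f 2F → f 2F < f 3F → Increasing f
increasing₄ f p q r 0F 1F _ = p
increasing₄ f p q r 0F 2F _ = ℕₚ.<-trans p q
increasing₄ f p q r 0F 3F _ = ℕₚ.<-trans p (ℕₚ.<-trans q r)
increasing₄ f p q r 1F 2F _ = q
increasing₄ f p q r 1F 3F _ = ℕₚ.<-trans q r
increasing₄ f p q r 2F 3F _ = r
increasing₄ f p q r 0F 0F ()
increasing₄ f p q r 1F 0F ()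
increasing₄ f p q r 1F 1F (s≤s ())
increasing₄ f p q r 2F 0F ()
increasing₄ f p q r 2F 1F (s≤s ())
increasing₄ f p q r 2F 2F (s≤s (s≤s ()))
increasing₄ f p q r 3F 0F ()
increasing₄ f p q r 3F 1F (s≤s ())
increasing₄ f p q r 3F 2F (s≤s (s≤s ()))
increasing₄ f p q r 3F 3F (s≤s (s≤s (s≤s ())))

-- For an involution `q`, the letter of rank i stands at position `lookup q i`, so listing the
-- letters by rank compares them all. Both 1324 and 4231 are involutions.
occurrence-involution : ∀ {m n} (q : Word m) (π : Word n) (p : Vec (Fin n) m) →
  (∀ i → lookup q (lookup q i) ≡ i) → Increasing (λ i → toℕ (lookup p i)) →
  Increasing (λ i → val π (lookup p (lookup q i))) → Occurrence q π p
occurrence-involution q π p invol pos values = pos , λ i j → mk⇔ (forth i j) (back i j)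
  where
  forth : ∀ i j → lookup q i Fin.< lookup q j → val π (lookup p i) < val π (lookup p j)
  forth i j lt = subst₂ (λ i j → val π (lookup p i) < val π (lookup p j)) (invol i) (invol j)
                        (values (lookup q i) (lookup q j) lt)
  back : ∀ i j → val π (lookup p i) < val π (lookup p j) → lookup q i Fin.< lookup q j
  back i j lt with Finₚ.<-cmp (lookup q i) (lookup q j)
  ... | tri< qi<qj _ _ = qi<qj
  ... | tri> _ _ qj<qi = contradiction (forth j i qj<qi) (ℕₚ.<-asym lt)
  ... | tri≈ _ qi≡qj _ with refl ← trans (sym (invol i)) (trans (cong (lookup q) qi≡qj) (invol j)) =
    contradiction lt (ℕₚ.<-irrefl refl)

module _ {n} (π : Word n) where

  contains⇒1324 : Contains π (proj₂ p1324) → Has1324 π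
  contains⇒1324 (a ∷ b ∷ c ∷ d ∷ [] , pos , iso) = a , b , c , d ,
    (pos 0F 1F (s≤s z≤n) , pos 1F 2F (s≤s (s≤s z≤n)) , pos 2F 3F (s≤s (s≤s (s≤s z≤n)))) ,
    (Equivalence.to (iso 0F 2F) (s≤s z≤n) , Equivalence.to (iso 2F 1F) (s≤s (s≤s z≤n)) ,
     Equivalence.to (iso 1F 3F) (s≤s (s≤s (s≤s z≤n))))

  contains⇒4231 : Contains π (proj₂ p4231) → Has4231 π
  contains⇒4231 (a ∷ b ∷ c ∷ d ∷ [] , pos , iso) = a , b , c , d ,
    (pos 0F 1F (s≤s z≤n) , pos 1F 2F (s≤s (s≤s z≤n)) , pos 2F 3F (s≤s (s≤s (s≤s z≤n)))) ,
    (Equivalence.to (iso 3F 1F) (s≤s z≤n) , Equivalence.to (iso 1F 2F) (s≤s (s≤s z≤n)) ,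
     Equivalence.to (iso 2F 0F) (s≤s (s≤s (s≤s z≤n))))

  1324⇒contains : Has1324 π → Contains π (proj₂ p1324)
  1324⇒contains (a , b , c , d , (a<b , b<c , c<d) , (v₁ , v₂ , v₃)) = a ∷ b ∷ c ∷ d ∷ [] ,
    occurrence-involution (proj₂ p1324) π (a ∷ b ∷ c ∷ d ∷ [])
      (λ { 0F → refl ; 1F → refl ; 2F → refl ; 3F → refl })
      (increasing₄ _ a<b b<c c<d) (increasing₄ _ v₁ v₂ v₃)

  4231⇒contains : Has4231 π → Contains π (proj₂ p4231)
  4231⇒contains (a , b , c , d , (a<b , b<c , c<d) , (v₁ , v₂ , v₃)) = a ∷ b ∷ c ∷ d ∷ [] ,
    occurrence-involution (proj₂ p4231) π (a ∷ b ∷ c ∷ d ∷ [])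
      (λ { 0F → refl ; 1F → refl ; 2F → refl ; 3F → refl })
      (increasing₄ _ a<b b<c c<d) (increasing₄ _ v₁ v₂ v₃)

-- Reverse complements

rc : ∀ {n} → Word n → Word n
rc π = tabulate (λ i → opposite (lookup π (opposite i)))

opposite-< : ∀ {n} {i j : Fin n} → i Fin.< j → opposite j Fin.< opposite i
opposite-< {n} {i} {j} i<j = subst₂ _<_ (sym (Finₚ.opposite-prop j)) (sym (Finₚ.opposite-prop i))
  (ℕₚ.∸-monoʳ-< (s≤s i<j) (Finₚ.toℕ<n j))

module _ {n} (π : Word n) where

  lookup-rc : ∀ i → lookup (rc π) i ≡ opposite (lookup π (opposite i))
  lookup-rc = Vecₚ.lookup∘tabulate _

  rc-involutive : rc (rc π) ≡ π
  rc-involutive = lookup-ext λ i → trans (Vecₚ.lookup∘tabulate _ i)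
    (trans (cong opposite (lookup-rc (opposite i)))
           (trans (Finₚ.opposite-involutive _) (cong (lookup π) (Finₚ.opposite-involutive i))))

  rc-< : ∀ {i j} → val π i < val π j → val (rc π) (opposite j) < val (rc π) (opposite i)
  rc-< {i} {j} lt = subst₂ (λ x y → toℕ x < toℕ y) (eq j) (eq i) (opposite-< lt)
    where
    eq : ∀ i → opposite (lookup π i) ≡ lookup (rc π) (opposite i)
    eq i = sym (trans (lookup-rc (opposite i)) (cong (opposite ∘ lookup π) (Finₚ.opposite-involutive i)))

opposite-injective : ∀ {n} {i j : Fin n} → opposite i ≡ opposite j → i ≡ j
opposite-injective {i = i} {j} eq =
  trans (sym (Finₚ.opposite-involutive i)) (trans (cong opposite eq) (Finₚ.opposite-involutive j))

perm-rc : ∀ {n} {π : Word n} → Perm π → Perm (rc π)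
perm-rc {π = π} p {i} {j} eq =
  opposite-injective (p (opposite-injective (trans (sym (lookup-rc π i)) (trans eq (lookup-rc π j)))))

rc-inversion : ∀ {n} (π : Word n) {i j} → Inversion π (i , j) → Inversion (rc π) (opposite j , opposite i)
rc-inversion π (i<j , πj<πi) = opposite-< i<j , rc-< π πj<πi

inv-rc : ∀ {n} (π : Word n) → inv (rc π) ≡ inv π
inv-rc π = enum-unique (enum-inv (rc π)) (enum-map (λ (i , j) → opposite j , opposite i)
  (λ _ _ eq → cong₂ _,_ (opposite-injective (cong proj₂ eq)) (opposite-injective (cong proj₁ eq)))
  (rc-inversion π)
  (λ {(i , j)} ij → (opposite j , opposite i) ,
    subst (λ π → Inversion π (opposite j , opposite i)) (rc-involutive π) (rc-inversion (rc π) ij) ,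
    cong₂ _,_ (Finₚ.opposite-involutive i) (Finₚ.opposite-involutive j))
  (enum-inv π))

module _ {n} (π : Word n) where

  rc-132 : Has132 π → Has213 (rc π)
  rc-132 (a , b , c , a<b , b<c , a<c , c<b) = opposite c , opposite b , opposite a ,
    opposite-< b<c , opposite-< a<b , rc-< π c<b , rc-< π a<c

  rc-213 : Has213 π → Has132 (rc π)
  rc-213 (a , b , c , a<b , b<c , b<a , a<c) = opposite c , opposite b , opposite a ,
    opposite-< b<c , opposite-< a<b , rc-< π a<c , rc-< π b<a

  rc-4231 : Has4231 π → Has4231 (rc π)
  rc-4231 (a , b , c , d , (a<b , b<c , c<d) , (d<b , b<c′ , c<a)) =
    opposite d , opposite c , opposite b , opposite a ,
    (opposite-< c<d , opposite-< b<c , opposite-< a<b) , (rc-< π c<a , rc-< π b<c′ , rc-< π d<b)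

-- Inserting a first letter

ins : ∀ {n} → Fin (suc n) → Word n → Word (suc n)
ins x w = x ∷ Vec.map (punchIn x) w

toℕ-punchIn-< : ∀ {n} (x : Fin (suc n)) (z : Fin n) → toℕ z < toℕ x → toℕ (punchIn x z) ≡ toℕ z
toℕ-punchIn-< (suc x) zero    _         = refl
toℕ-punchIn-< (suc x) (suc z) (s≤s z<x) = cong suc (toℕ-punchIn-< x z z<x)

toℕ-punchIn-≥ : ∀ {n} (x : Fin (suc n)) (z : Fin n) → toℕ x ≤ toℕ z → toℕ (punchIn x z) ≡ suc (toℕ z)
toℕ-punchIn-≥ zero    z       _         = refl
toℕ-punchIn-≥ (suc x) (suc z) (s≤s x≤z) = cong suc (toℕ-punchIn-≥ x z x≤z)

module _ {n} (x : Fin (suc n)) (w : Word n) where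

  val-ins-< : ∀ {i} → val w i < toℕ x → val (ins x w) (suc i) ≡ val w i
  val-ins-< {i} lt = trans (cong toℕ (Vecₚ.lookup-map i (punchIn x) w)) (toℕ-punchIn-< x _ lt)

  val-ins-≥ : ∀ {i} → toℕ x ≤ val w i → val (ins x w) (suc i) ≡ suc (val w i)
  val-ins-≥ {i} le = trans (cong toℕ (Vecₚ.lookup-map i (punchIn x) w)) (toℕ-punchIn-≥ x _ le)

  ins-below⁺ : ∀ {i} → val w i < toℕ x → val (ins x w) (suc i) < toℕ x
  ins-below⁺ lt = subst (_< toℕ x) (sym (val-ins-< lt)) lt

  ins-above⁺ : ∀ {i} → toℕ x ≤ val w i → toℕ x < val (ins x w) (suc i)
  ins-above⁺ le = subst (toℕ x <_) (sym (val-ins-≥ le)) (s≤s le)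

  ins-below⁻ : ∀ {i} → val (ins x w) (suc i) ≤ toℕ x → val w i < toℕ x
  ins-below⁻ le = ℕₚ.≰⇒> λ x≤ → ℕₚ.<⇒≱ (ins-above⁺ x≤) le

  ins-above⁻ : ∀ {i} → toℕ x ≤ val (ins x w) (suc i) → toℕ x ≤ val w i
  ins-above⁻ le = ℕₚ.≮⇒≥ λ <x → ℕₚ.<⇒≱ (ins-below⁺ <x) le

  ins-mono : ∀ {i j} → val w i < val w j → val (ins x w) (suc i) < val (ins x w) (suc j)
  ins-mono {i} {j} lt = subst₂ (λ y z → toℕ y < toℕ z)
    (sym (Vecₚ.lookup-map i (punchIn x) w)) (sym (Vecₚ.lookup-map j (punchIn x) w))
    (ℕₚ.≰⇒> (ℕₚ.<⇒≱ lt ∘ Finₚ.punchIn-cancel-≤ x (lookup w j) (lookup w i)))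

  ins-cancel : ∀ {i j} → val (ins x w) (suc i) < val (ins x w) (suc j) → val w i < val w j
  ins-cancel {i} {j} lt = ℕₚ.≰⇒> λ le → ℕₚ.<⇒≱ lt (subst₂ (λ y z → toℕ y ≤ toℕ z)
    (sym (Vecₚ.lookup-map j (punchIn x) w)) (sym (Vecₚ.lookup-map i (punchIn x) w))
    (Finₚ.punchIn-mono-≤ x (lookup w j) (lookup w i) le))

  perm-ins : Perm w → Perm (ins x w)
  perm-ins p {zero}  {zero}  _  = refl
  perm-ins p {zero}  {suc j} eq =
    contradiction (sym (trans eq (Vecₚ.lookup-map j (punchIn x) w))) (Finₚ.punchInᵢ≢i x _)
  perm-ins p {suc i} {zero}  eq =
    contradiction (trans (sym (Vecₚ.lookup-map i (punchIn x) w)) eq) (Finₚ.punchInᵢ≢i x _)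
  perm-ins p {suc i} {suc j} eq = cong suc (p (Finₚ.punchIn-injective x _ _
    (trans (sym (Vecₚ.lookup-map i (punchIn x) w)) (trans eq (Vecₚ.lookup-map j (punchIn x) w)))))

  perm-ins⁻ : Perm (ins x w) → Perm w
  perm-ins⁻ p {i} {j} eq = Finₚ.suc-injective (p
    (trans (Vecₚ.lookup-map i (punchIn x) w)
      (trans (cong (punchIn x) eq) (sym (Vecₚ.lookup-map j (punchIn x) w)))))

  ins-132 : Has132 w → Has132 (ins x w)
  ins-132 (a , b , c , a<b , b<c , a<c , c<b) =
    suc a , suc b , suc c , s≤s a<b , s≤s b<c , ins-mono a<c , ins-mono c<b

  ins-4231 : Has4231 w → Has4231 (ins x w)
  ins-4231 (a , b , c , d , (a<b , b<c , c<d) , (v₁ , v₂ , v₃)) = suc a , suc b , suc c , suc d ,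
    (s≤s a<b , s≤s b<c , s≤s c<d) , (ins-mono v₁ , ins-mono v₂ , ins-mono v₃)

  -- The first letter exceeds exactly `toℕ x` letters, all to its right. They are enumerated by
  -- value and located through the surjectivity of `w`; the other inversions are those of `w`.
  inv-ins : Perm w → inv (ins x w) ≡ toℕ x + inv w
  inv-ins p = enum-unique (enum-inv (ins x w))
    (enum-map pair (λ {s} {t} → inj {s} {t}) (λ {s} → to {s}) from
      (enum-⊎ (enum-Fin< (toℕ x) (ℕₚ.<⇒≤pred (Finₚ.toℕ<n x))) (enum-inv w)))
    where
    pos : ∀ v → ∃[ j ] lookup w j ≡ v
    pos = injective⇒surjective (lookup w) p
    pair : Fin n ⊎ Fin n × Fin n → Fin (suc n) × Fin (suc n)
    pair (inj₁ v)       = zero , suc (proj₁ (pos v))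
    pair (inj₂ (i , j)) = suc i , suc j
    R = [ (λ v → toℕ v < toℕ x) , Inversion w ]′
    inj : ∀ {s t} → R s → R t → pair s ≡ pair t → s ≡ t
    inj {inj₁ u} {inj₁ v} _ _ eq = cong inj₁ (trans (sym (proj₂ (pos u)))
      (trans (cong (lookup w) (Finₚ.suc-injective (cong proj₂ eq))) (proj₂ (pos v))))
    inj {inj₂ _} {inj₂ _} _ _ refl = refl
    to : ∀ {s} → R s → Inversion (ins x w) (pair s)
    to {inj₁ v} v<x = s≤s z≤n , ins-below⁺ (subst (λ u → toℕ u < toℕ x) (sym (proj₂ (pos v))) v<x)
    to {inj₂ _} (i<j , wj<wi) = s≤s i<j , ins-mono wj<wi
    from : ∀ {ij} → Inversion (ins x w) ij → ∃[ s ] R s × pair s ≡ ij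
    from {zero , zero}   (() , _)
    from {suc i , zero}  (() , _)
    from {zero , suc j}  (_ , lt) = inj₁ (lookup w j) , ins-below⁻ (ℕₚ.<⇒≤ lt) ,
      cong (λ j → zero , suc j) (p (proj₂ (pos (lookup w j))))
    from {suc i , suc j} (s≤s i<j , lt) = inj₂ (i , j) , (i<j , ins-cancel lt) , refl

ins-injective : ∀ {n} {x y : Fin (suc n)} {v w : Word n} → ins x v ≡ ins y w → x ≡ y × v ≡ w
ins-injective {x = x} {v = v} {w} eq with refl ← Vecₚ.∷-injectiveˡ eq =
  refl , lookup-ext λ i → Finₚ.punchIn-injective x _ _
    (trans (sym (Vecₚ.lookup-map i (punchIn x) v))
           (trans (cong (λ u → lookup u i) (Vecₚ.∷-injectiveʳ eq)) (Vecₚ.lookup-map i (punchIn x) w)))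

ins-surjective : ∀ {n} {π : Word (suc n)} → Perm π → ∃[ x ] ∃[ w ] ins x w ≡ π
ins-surjective {π = x ∷ v} p = x , tabulate (λ i → punchOut (x≢ i)) , cong (x ∷_) (lookup-ext λ i →
  trans (Vecₚ.lookup-map i (punchIn x) (tabulate (λ i → punchOut (x≢ i))))
    (trans (cong (punchIn x) (Vecₚ.lookup∘tabulate (λ i → punchOut (x≢ i)) i))
           (Finₚ.punchIn-punchOut (x≢ i))))
  where
  x≢ : ∀ i → x ≢ lookup v i
  x≢ i eq = contradiction (p {zero} {suc i} eq) λ ()

-- Decoding a partition, padded with zeros, as a Lehmer code

tl : List ℕ → List ℕ
tl []      = []
tl (_ ∷ l) = l

-- An entry that exceeds m is truncated; this never happens to codes that are Valid.

clamp : ∀ m → ℕ → Fin (suc m)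
clamp m x = Fin.fromℕ< (s≤s (ℕₚ.m⊓n≤n x m))

toℕ-clamp : ∀ {m x} → x ≤ m → toℕ (clamp m x) ≡ x
toℕ-clamp {m} {x} x≤m = trans (Finₚ.toℕ-fromℕ< _) (ℕₚ.m≤n⇒m⊓n≡m x≤m)

decode : ∀ m → List ℕ → Word m
decode zero    l = []
decode (suc m) l = ins (clamp m (hd l)) (decode m (tl l))

-- The condition for the padded list to be the Lehmer code of a permutation of m letters.
Valid : ℕ → List ℕ → Set
Valid zero    l = l ≡ []
Valid (suc m) l = hd l ≤ m × Valid m (tl l)

perm-decode : ∀ m l → Perm (decode m l)
perm-decode (suc m) l = perm-ins _ _ (perm-decode m (tl l))

strict-tl : ∀ {l} → Strict l → Strict (tl l)
strict-tl []      = []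
strict-tl (_ ∷ s) = s

good-tl : ∀ {l} → Good l → Good (tl l)
good-tl (strict s) = strict (strict-tl s)
good-tl (same g)   = g
good-tl (up g)     = g

good-hd : ∀ {l} → Good l → hd (tl l) ≤ hd l
good-hd (strict [])        = z≤n
good-hd (strict (l<x ∷ _)) = ℕₚ.<⇒≤ l<x
good-hd (same _)           = ℕₚ.≤-refl
good-hd (up _)             = ℕₚ.n≤1+n _

good-[] : ∀ {l} → Good l → hd l ≡ 0 → l ≡ []
good-[] (strict [])         _    = refl
good-[] (strict (l<0 ∷ _)) refl = contradiction l<0 λ ()

sum-hd-tl : ∀ l → hd l + sumₗ (tl l) ≡ sumₗ l
sum-hd-tl []      = refl
sum-hd-tl (_ ∷ _) = refl

valid-[] : ∀ m → Valid m []
valid-[] zero    = refl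
valid-[] (suc m) = z≤n , valid-[] m

-- Each part is positive, so the remaining sum drops by at least one with every letter and stays
-- below the number of letters left.
valid-sum : ∀ {m l} → Good l → sumₗ l < m → Valid m l
valid-sum {suc m} {[]}        g _         = valid-[] (suc m)
valid-sum {suc m} {zero ∷ l}  g _         = contradiction (good-[] g refl) λ ()
valid-sum {suc m} {suc x ∷ l} g (s≤s x+l<m) =
  ℕₚ.m+n≤o⇒m≤o (suc x) x+l<m ,
  valid-sum (good-tl g) (ℕₚ.≤-trans (s≤s (ℕₚ.m≤n+m (sumₗ l) x)) x+l<m)

inv-decode : ∀ {m l} → Valid m l → inv (decode m l) ≡ sumₗ l
inv-decode {zero}      refl    = refl
inv-decode {suc m} {l} (h , v) = trans (inv-ins _ _ (perm-decode m (tl l)))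
  (trans (cong₂ _+_ (toℕ-clamp h) (inv-decode v)) (sum-hd-tl l))

decode-injective : ∀ {m l l′} → Good l → Good l′ → Valid m l → Valid m l′ →
  decode m l ≡ decode m l′ → l ≡ l′
decode-injective {zero}          _ _  refl    refl      _  = refl
decode-injective {suc m} {l} {l′} g g′ (h , v) (h′ , v′) eq with ins-injective eq
... | x≡x′ , w≡w′ = hd-tl (trans (sym (toℕ-clamp h)) (trans (cong toℕ x≡x′) (toℕ-clamp h′)))
                          (decode-injective (good-tl g) (good-tl g′) v v′ w≡w′) g g′
  where
  -- The empty list and the list with the single part 0 have the same `hd` and `tl`; goodness rules
  -- out the part 0.
  hd-tl : ∀ {l l′} → hd l ≡ hd l′ → tl l ≡ tl l′ → Good l → Good l′ → l ≡ l′
  hd-tl {[]}             eq _  _ g′ = sym (good-[] g′ (sym eq))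
  hd-tl {_ ∷ _} {[]}     eq _  g _  = good-[] g eq
  hd-tl {_ ∷ _} {_ ∷ _}  eq eq′ _ _ = cong₂ _∷_ eq eq′

-- Good codes and pattern avoidance

-- The first letter is `hd l`, so no letter that is at least `t` lies below it. For two later
-- letters it is deleted, and the induction continues with `hd l` as threshold, which is at least
-- `hd (tl l)`.
increasing-above : ∀ {m l t} → Good l → Valid m l → hd l ≤ t → ∀ {i j} → i Fin.< j →
  t ≤ val (decode m l) i → t ≤ val (decode m l) j → val (decode m l) i < val (decode m l) j
increasing-above {suc m} {l} g (h , v) hd≤t {zero} {suc j} _ t≤i t≤j =
  ins-above⁺ x w (ins-above⁻ x w (ℕₚ.≤-trans (ℕₚ.≤-reflexive (toℕ-clamp h)) (ℕₚ.≤-trans hd≤t t≤j)))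
  where x = clamp m (hd l) ; w = decode m (tl l)
increasing-above {suc m} {l} g (h , v) hd≤t {suc i} {suc j} (s≤s i<j) t≤i t≤j =
  ins-mono x w (increasing-above (good-tl g) v (ℕₚ.≤-trans (good-hd g) (ℕₚ.≤-reflexive (sym (toℕ-clamp h))))
    i<j (ins-above⁻ x w (ℕₚ.≤-trans x≤t t≤i)) (ins-above⁻ x w (ℕₚ.≤-trans x≤t t≤j)))
  where
  x = clamp m (hd l) ; w = decode m (tl l)
  x≤t = ℕₚ.≤-trans (ℕₚ.≤-reflexive (toℕ-clamp h)) hd≤t

good⇒¬132 : ∀ {m l} → Good l → Valid m l → ¬ Has132 (decode m l)
good⇒¬132 {suc m} {l} g (h , v) (zero , suc b , suc c , _ , s≤s b<c , a<c , c<b) =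
  ℕₚ.<-asym (ins-cancel x w c<b)
    (increasing-above (good-tl g) v (ℕₚ.≤-trans (good-hd g) (ℕₚ.≤-reflexive (sym (toℕ-clamp h)))) b<c
      (ins-above⁻ x w (ℕₚ.<⇒≤ (ℕₚ.<-trans a<c c<b))) (ins-above⁻ x w (ℕₚ.<⇒≤ a<c)))
  where x = clamp m (hd l) ; w = decode m (tl l)
good⇒¬132 {suc m} {l} g (h , v) (suc a , suc b , suc c , s≤s a<b , s≤s b<c , a<c , c<b) =
  good⇒¬132 (good-tl g) v (a , b , c , a<b , b<c , ins-cancel x w a<c , ins-cancel x w c<b)
  where x = clamp m (hd l) ; w = decode m (tl l)

-- Deleting the first letter lowers the threshold by one, and the next part of a strict code is
-- smaller by at least one too, so the hypothesis persists until the threshold is 0.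
strict-stays-above : ∀ {m l t} → Strict l → Valid m l → hd l < t → ∀ {i j} → i Fin.< j →
  t ≤ val (decode m l) i → t ≤ val (decode m l) j
strict-stays-above {suc m} {l} s (h , v) hd<t {zero} _ t≤i =
  contradiction (ℕₚ.≤-trans hd<t t≤i) (ℕₚ.≤⇒≯ (ℕₚ.≤-reflexive (toℕ-clamp h)))
strict-stays-above {suc m} {l} {suc t} s (h , v) (s≤s hd≤t) {suc i} {suc j} (s≤s i<j) t<i =
  subst (suc t ≤_) (sym (val-ins-≥ x w (ℕₚ.≤-trans x≤t t≤j))) (s≤s t≤j)
  where
  x = clamp m (hd l) ; w = decode m (tl l)
  x≤t : toℕ x ≤ t
  x≤t = ℕₚ.≤-trans (ℕₚ.≤-reflexive (toℕ-clamp h)) hd≤t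
  x≤i : toℕ x ≤ val w i
  x≤i = ins-above⁻ x w (ℕₚ.≤-trans x≤t (ℕₚ.<⇒≤ t<i))
  t≤i : t ≤ val w i
  t≤i = ℕₚ.<⇒≤pred (subst (suc t ≤_) (val-ins-≥ x w x≤i) t<i)
  hd-tl< : ∀ {l t} → Strict l → hd l ≤ t → t ≡ 0 ⊎ hd (tl l) < t
  hd-tl< {t = zero}  _         _    = inj₁ refl
  hd-tl< {t = suc t} []        _    = inj₂ (s≤s z≤n)
  hd-tl< {t = suc t} (l<x ∷ _) x≤t = inj₂ (ℕₚ.≤-trans l<x x≤t)
  t≤j : t ≤ val w j
  t≤j with hd-tl< s hd≤t
  ... | inj₁ refl = z≤n
  ... | inj₂ hd<t = strict-stays-above (strict-tl s) v hd<t i<j t≤i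

-- If the first letter is the 2, the larger letter taken as the 3 keeps every later letter above the
-- first one, by `strict-stays-above`, which leaves no 1.
strict⇒¬231 : ∀ {m l t} → Strict l → Valid m l → ¬ Has231Below (decode m l) t
strict⇒¬231 {suc m} {l} s (h , v) (zero , suc b , suc c , (_ , s≤s b<c) , (c<a , a<b , _)) with s
... | [] = contradiction (ℕₚ.≤-trans c<a (ℕₚ.≤-reflexive (toℕ-clamp h))) λ ()
... | l<x ∷ s′ = ℕₚ.<⇒≱ (ins-below⁻ x w (ℕₚ.<⇒≤ c<a))
  (strict-stays-above s′ v (ℕₚ.≤-trans l<x (ℕₚ.≤-reflexive (sym (toℕ-clamp h)))) b<c
    (ins-above⁻ x w (ℕₚ.<⇒≤ a<b)))
  where x = clamp m (hd l) ; w = decode m (tl l)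
strict⇒¬231 {suc m} {l} s (h , v) (suc a , suc b , suc c , (s≤s a<b , s≤s b<c) , (c<a , a<b′ , _)) =
  strict⇒¬231 (strict-tl s) v
    -- The bound is chosen afresh, one above the letter that plays the 3.
    (a , b , c , (a<b , b<c) , (ins-cancel x w c<a , ins-cancel x w a<b′ , ℕₚ.n<1+n _))
  where x = clamp m (hd l) ; w = decode m (tl l)

-- Outside the strict case, `t` is the next part or one more, so no letter lies strictly between the
-- first letter and `t`. The first letter is therefore not the 2; deleting it makes its own value
-- the new bound.
good⇒¬231 : ∀ {m t l} → Good (t ∷ l) → Valid m l → ¬ Has231Below (decode m l) t
good⇒¬231 (strict (_ ∷ s)) v = strict⇒¬231 s v
good⇒¬231 {suc m} (same {y} {l} g) (h , v) (zero , b , c , _ , (_ , a<b , b<t)) =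
  ℕₚ.<-asym (subst (_< val (decode (suc m) (suc y ∷ l)) b) (toℕ-clamp h) a<b) b<t
good⇒¬231 {suc m} (same {y} {l} g) (h , v)
  (suc a , suc b , suc c , (s≤s a<b , s≤s b<c) , (c<a , a<b′ , b<t)) =
  good⇒¬231 g v (a , b , c , (a<b , b<c) , (ins-cancel x w c<a , ins-cancel x w a<b′ ,
    subst (_ <_) (toℕ-clamp h)
      (ins-below⁻ x w (ℕₚ.≤-trans (ℕₚ.<⇒≤ b<t) (ℕₚ.≤-reflexive (sym (toℕ-clamp h)))))))
  where x = clamp m (suc y) ; w = decode m l
good⇒¬231 {suc m} (up {y} {l} g) (h , v) (zero , b , c , _ , (_ , a<b , s≤s b≤x)) =
  ℕₚ.<⇒≱ (subst (_< val (decode (suc m) (suc y ∷ l)) b) (toℕ-clamp h) a<b) b≤x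
good⇒¬231 {suc m} (up {y} {l} g) (h , v)
  (suc a , suc b , suc c , (s≤s a<b , s≤s b<c) , (c<a , a<b′ , s≤s b≤x)) =
  good⇒¬231 g v (a , b , c , (a<b , b<c) , (ins-cancel x w c<a , ins-cancel x w a<b′ ,
    subst (_ <_) (toℕ-clamp h)
      (ins-below⁻ x w (ℕₚ.≤-trans b≤x (ℕₚ.≤-reflexive (sym (toℕ-clamp h)))))))
  where x = clamp m (suc y) ; w = decode m l

good⇒¬4231 : ∀ {m l} → Good l → Valid m l → ¬ Has4231 (decode m l)
good⇒¬4231 {suc m} {[]} g (h , v) (zero , b , c , d , _ , (_ , _ , c<a)) =
  contradiction (ℕₚ.≤-trans c<a (ℕₚ.≤-reflexive (toℕ-clamp h))) λ ()
good⇒¬4231 {suc m} {t ∷ l} g (h , v)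
  (zero , suc b , suc c , suc d , (_ , s≤s b<c , s≤s c<d) , (d<b , b<c′ , c<a)) =
  good⇒¬231 g v (b , c , d , (b<c , c<d) , (ins-cancel x w d<b , ins-cancel x w b<c′ ,
    subst (_ <_) (toℕ-clamp h) (ins-below⁻ x w (ℕₚ.<⇒≤ c<a))))
  where x = clamp m t ; w = decode m l
good⇒¬4231 {suc m} {l} g (h , v)
  (suc a , suc b , suc c , suc d , (s≤s a<b , s≤s b<c , s≤s c<d) , (d<b , b<c′ , c<a)) =
  good⇒¬4231 (good-tl g) v (a , b , c , d , (a<b , b<c , c<d) ,
    (ins-cancel x w d<b , ins-cancel x w b<c′ , ins-cancel x w c<a))
  where x = clamp m (hd l) ; w = decode m (tl l)

-- Two equal parts y + 1 at the front give the first letters y + 1 and y + 2, and the letter 0 comes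
-- later: a 231. Each `up` raises the bound by one and the 3 by at most one. A part of at least
-- `2 + hd l` put in front would complete this to a 4231.
strict⊎231 : ∀ {m l} → Good l → Valid m l → Strict l ⊎ Has231Below (decode m l) (2 + hd l)
strict⊎231 (strict s) _ = inj₁ s
strict⊎231 {zero}        (same _) ()
strict⊎231 {zero}        (up _)   ()
strict⊎231 {suc zero}    (same _) (_ , ())
strict⊎231 {suc (suc m)} (same {y} {l} g) (h , h′ , v) =
  inj₂ (third (position π (perm-decode (suc (suc m)) (suc y ∷ suc y ∷ l)) 0 (s≤s z≤n)))
  where
  π = decode (suc (suc m)) (suc y ∷ suc y ∷ l)
  val₀ : val π zero ≡ suc y
  val₀ = toℕ-clamp h
  val₁ : val π (suc zero) ≡ 2 + y
  val₁ = trans (val-ins-≥ _ (decode (suc m) (suc y ∷ l)) {zero}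
                 (ℕₚ.≤-reflexive (trans val₀ (sym (toℕ-clamp h′))))) (cong suc (toℕ-clamp h′))
  third : ∃[ c ] val π c ≡ 0 → Has231Below π (3 + y)
  third (zero , eq)        = contradiction (trans (sym val₀) eq) λ ()
  third (suc zero , eq)    = contradiction (trans (sym val₁) eq) λ ()
  third (suc (suc c) , eq) = zero , suc zero , suc (suc c) , (s≤s z≤n , s≤s (s≤s z≤n)) ,
    ( subst₂ _<_ (sym eq) (sym val₀) (s≤s z≤n)
    , subst₂ _<_ (sym val₀) (sym val₁) ℕₚ.≤-refl
    , subst (_< 3 + y) (sym val₁) ℕₚ.≤-refl )
strict⊎231 {suc m} (up {y} {l} g) (h , v) with strict⊎231 g v
... | inj₁ s = inj₁ (ℕₚ.n<1+n _ ∷ s)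
... | inj₂ (a , b , c , (a<b , b<c) , (c<a , a<b′ , b<)) =
  inj₂ (suc a , suc b , suc c , (s≤s a<b , s≤s b<c) , (ins-mono x w c<a , ins-mono x w a<b′ , bound))
  where
  x = clamp m (2 + y) ; w = decode m (suc y ∷ l)
  bound : val (ins x w) (suc b) < 4 + y
  bound with val w b ℕₚ.<? toℕ x
  ... | yes b<x = ℕₚ.≤-trans (s≤s (ℕₚ.≤-reflexive (val-ins-< x w b<x))) (ℕₚ.m≤n⇒m≤1+n b<)
  ... | no  b≮x = s≤s (ℕₚ.≤-trans (ℕₚ.≤-reflexive (val-ins-≥ x w (ℕₚ.≮⇒≥ b≮x))) b<)

GoodCode : ∀ {m} → Word m → Set
GoodCode {m} π = ∃[ l ] Good l × Valid m l × decode m l ≡ π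

-- Induction by removing the first letter x. Avoiding 132 makes x at least the next part; if it
-- exceeds that part by 2 or more, avoiding 4231 makes the remaining code strict, by `strict⊎231`.
avoider⇒good : ∀ {m} {π : Word m} → Perm π → ¬ Has132 π → ¬ Has4231 π → GoodCode π
avoider⇒good {zero}  {[]} _ _ _ = [] , strict [] , refl , refl
avoider⇒good {suc m} {π}  p ¬132 ¬4231 with ins-surjective {π = π} p
... | x , w , refl
  with avoider⇒good {π = w} (perm-ins⁻ x w p) (¬132 ∘ ins-132 x w) (¬4231 ∘ ins-4231 x w)
... | l , g , v , refl = extend (toℕ x) refl
  where
  x≤m = ℕₚ.<⇒≤pred (Finₚ.toℕ<n x)

  done : ∀ l′ → Good l′ → tl l′ ≡ l → hd l′ ≡ toℕ x → GoodCode (ins x w)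
  done l′ g′ refl hd≡ = l′ , g′ , (hd≤m , v) ,
    cong (λ x → ins x w) (Finₚ.toℕ-injective (trans (toℕ-clamp hd≤m) hd≡))
    where hd≤m = ℕₚ.≤-trans (ℕₚ.≤-reflexive hd≡) x≤m

  -- If x were below `hd l`, then the letters x, `1 + hd l` and x + 1 would form a 132.
  descent : ∀ {m} (x : Fin (suc m)) l → Valid m l → ¬ Has132 (ins x (decode m l)) → hd l ≤ toℕ x
  descent {zero}  x l refl    ¬132 = z≤n
  descent {suc m} x l (h , v) ¬132 = ℕₚ.≮⇒≥ λ x<hd →
    let w = decode (suc m) l
        s , s≡ = position w (perm-decode (suc m) l) (toℕ x) (s≤s (ℕₚ.≤-trans (ℕₚ.<⇒≤ x<hd) h))
    in ¬132 (zero , suc zero , suc s , s≤s z≤n , s≤s (0<s x<hd s≡) ,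
             ins-above⁺ x w {s} (ℕₚ.≤-reflexive (sym s≡)) ,
             ins-mono x w {s} {zero} (subst₂ _<_ (sym s≡) (sym (toℕ-clamp h)) x<hd))
    where
    0<s : ∀ {s} → toℕ x < hd l → val (decode (suc m) l) s ≡ toℕ x → zero {m} Fin.< s
    0<s {suc _} _    _  = s≤s z≤n
    0<s {zero}  x<hd eq = contradiction x<hd (ℕₚ.<-irrefl (trans (sym eq) (toℕ-clamp h)))

  hd≤x : hd l ≤ toℕ x
  hd≤x = descent x l v ¬132

  extend : ∀ y → toℕ x ≡ y → GoodCode (ins x w)
  -- Zeros are padding and not parts: a first letter 0 forces `l` to be empty and leaves the code
  -- empty.
  extend zero    x≡0 = done [] (strict [])
    (sym (good-[] g (ℕₚ.n≤0⇒n≡0 (subst (hd l ≤_) x≡0 hd≤x)))) (sym x≡0)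
  extend (suc y) x≡  = done (suc y ∷ l) (near g (subst (hd l ≤_) x≡ hd≤x) strict-tail) refl (sym x≡)
    where
    near : ∀ {l} → Good l → hd l ≤ suc y → (2 + hd l ≤ suc y → Strict l) → Good (suc y ∷ l)
    near {[]} _ _ _ = strict (s≤s z≤n ∷ [])
    near {zero ∷ l} g _ _ = contradiction (good-[] g refl) λ ()
    near {suc z ∷ l} g z≤y s with ℕₚ.m≤n⇒m<n∨m≡n z≤y
    ... | inj₂ refl = same g
    ... | inj₁ (s≤s z<y) with ℕₚ.m≤n⇒m<n∨m≡n z<y
    ...   | inj₂ refl = up g
    ...   | inj₁ 1+z<y = strict (s≤s z<y ∷ s (s≤s 1+z<y))
    strict-tail : 2 + hd l ≤ suc y → Strict l
    strict-tail 2+hd≤x with strict⊎231 g v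
    ... | inj₁ s = s
    ... | inj₂ (a , b , c , (a<b , b<c) , (c<a , a<b′ , b<)) = contradiction
      (zero , suc a , suc b , suc c , (s≤s z≤n , s≤s a<b , s≤s b<c) ,
       (ins-mono x w c<a , ins-mono x w a<b′ ,
        ins-below⁺ x w (ℕₚ.≤-trans b< (ℕₚ.≤-trans 2+hd≤x (ℕₚ.≤-reflexive (sym x≡)))))) ¬4231

-- Direct sums

infixr 5 _⊞_

_⊞_ : ∀ {m n} → Word m → Word n → Word (m + n)
_⊞_ {m} {n} σ τ = Vec.map (_↑ˡ n) σ Vec.++ Vec.map (m ↑ʳ_) τ

data Side (m {n} : ℕ) : Fin (m + n) → Set where
  left  : ∀ i → Side m (i ↑ˡ n)
  right : ∀ j → Side m (m ↑ʳ j)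

side : ∀ m {n} (i : Fin (m + n)) → Side m i
side m i with Fin.splitAt m i in eq
... | inj₁ j = subst (Side m) (Finₚ.splitAt⁻¹-↑ˡ eq) (left j)
... | inj₂ j = subst (Side m) (Finₚ.splitAt⁻¹-↑ʳ eq) (right j)

module _ {m n : ℕ} where

  ↑ˡ-< : (i : Fin m) → toℕ (i ↑ˡ n) < m
  ↑ˡ-< i = subst (_< m) (sym (Finₚ.toℕ-↑ˡ i n)) (Finₚ.toℕ<n i)

  ↑ʳ-≥ : (j : Fin n) → m ≤ toℕ (m ↑ʳ j)
  ↑ʳ-≥ j = subst (m ≤_) (sym (Finₚ.toℕ-↑ʳ m j)) (ℕₚ.m≤m+n m (toℕ j))

  ↑ˡ-mono : {i j : Fin m} → i Fin.< j → (i ↑ˡ n) Fin.< (j ↑ˡ n)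
  ↑ˡ-mono {i} {j} = subst₂ _<_ (sym (Finₚ.toℕ-↑ˡ i n)) (sym (Finₚ.toℕ-↑ˡ j n))

  ↑ˡ-cancel : {i j : Fin m} → (i ↑ˡ n) Fin.< (j ↑ˡ n) → i Fin.< j
  ↑ˡ-cancel {i} {j} = subst₂ _<_ (Finₚ.toℕ-↑ˡ i n) (Finₚ.toℕ-↑ˡ j n)

  ↑ʳ-mono : {i j : Fin n} → i Fin.< j → (m ↑ʳ i) Fin.< (m ↑ʳ j)
  ↑ʳ-mono {i} {j} lt = subst₂ _<_ (sym (Finₚ.toℕ-↑ʳ m i)) (sym (Finₚ.toℕ-↑ʳ m j)) (ℕₚ.+-monoʳ-< m lt)

  ↑ʳ-cancel : {i j : Fin n} → (m ↑ʳ i) Fin.< (m ↑ʳ j) → i Fin.< j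
  ↑ʳ-cancel {i} {j} lt = ℕₚ.+-cancelˡ-< m _ _ (subst₂ _<_ (Finₚ.toℕ-↑ʳ m i) (Finₚ.toℕ-↑ʳ m j) lt)

  ↑ʳ≮↑ˡ : {i : Fin n} {j : Fin m} → ¬ (m ↑ʳ i) Fin.< (j ↑ˡ n)
  ↑ʳ≮↑ˡ {i} {j} lt = ℕₚ.<⇒≱ (ℕₚ.<-trans lt (↑ˡ-< j)) (↑ʳ-≥ i)

  ↑ˡ<↑ʳ : {i : Fin m} {j : Fin n} → (i ↑ˡ n) Fin.< (m ↑ʳ j)
  ↑ˡ<↑ʳ {i} {j} = ℕₚ.≤-trans (↑ˡ-< i) (↑ʳ-≥ j)

  ↑ˡ≢↑ʳ : {i : Fin m} {j : Fin n} → i ↑ˡ n ≢ m ↑ʳ j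
  ↑ˡ≢↑ʳ eq = ℕₚ.<-irrefl (cong toℕ eq) ↑ˡ<↑ʳ

module _ {m n : ℕ} (σ : Word m) (τ : Word n) where

  lookup-⊞ˡ : ∀ i → lookup (σ ⊞ τ) (i ↑ˡ n) ≡ lookup σ i ↑ˡ n
  lookup-⊞ˡ i = trans (Vecₚ.lookup-++ˡ (Vec.map (_↑ˡ n) σ) _ i) (Vecₚ.lookup-map i (_↑ˡ n) σ)

  lookup-⊞ʳ : ∀ j → lookup (σ ⊞ τ) (m ↑ʳ j) ≡ m ↑ʳ lookup τ j
  lookup-⊞ʳ j = trans (Vecₚ.lookup-++ʳ (Vec.map (_↑ˡ n) σ) _ j) (Vecₚ.lookup-map j (m ↑ʳ_) τ)

  ⊞-monoˡ : ∀ {i j} → val σ i < val σ j → val (σ ⊞ τ) (i ↑ˡ n) < val (σ ⊞ τ) (j ↑ˡ n)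
  ⊞-monoˡ {i} {j} lt = subst₂ Fin._<_ (sym (lookup-⊞ˡ i)) (sym (lookup-⊞ˡ j)) (↑ˡ-mono lt)

  ⊞-monoʳ : ∀ {i j} → val τ i < val τ j → val (σ ⊞ τ) (m ↑ʳ i) < val (σ ⊞ τ) (m ↑ʳ j)
  ⊞-monoʳ {i} {j} lt = subst₂ Fin._<_ (sym (lookup-⊞ʳ i)) (sym (lookup-⊞ʳ j)) (↑ʳ-mono lt)

  ⊞-cancelˡ : ∀ {i j} → val (σ ⊞ τ) (i ↑ˡ n) < val (σ ⊞ τ) (j ↑ˡ n) → val σ i < val σ j
  ⊞-cancelˡ {i} {j} lt = ↑ˡ-cancel {n = n} (subst₂ Fin._<_ (lookup-⊞ˡ i) (lookup-⊞ˡ j) lt)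

  ⊞-cancelʳ : ∀ {i j} → val (σ ⊞ τ) (m ↑ʳ i) < val (σ ⊞ τ) (m ↑ʳ j) → val τ i < val τ j
  ⊞-cancelʳ {i} {j} lt = ↑ʳ-cancel {m = m} (subst₂ Fin._<_ (lookup-⊞ʳ i) (lookup-⊞ʳ j) lt)

  ⊞-ˡ<ʳ : ∀ i j → val (σ ⊞ τ) (i ↑ˡ n) < val (σ ⊞ τ) (m ↑ʳ j)
  ⊞-ˡ<ʳ i j = subst₂ Fin._<_ (sym (lookup-⊞ˡ i)) (sym (lookup-⊞ʳ j)) ↑ˡ<↑ʳ

  ⊞-ʳ≮ˡ : ∀ {i j} → ¬ val (σ ⊞ τ) (m ↑ʳ j) < val (σ ⊞ τ) (i ↑ˡ n)
  ⊞-ʳ≮ˡ {i} {j} = ℕₚ.<-asym (⊞-ˡ<ʳ i j)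

  perm-⊞ : Perm σ → Perm τ → Perm (σ ⊞ τ)
  perm-⊞ p q {i} {j} eq with side m i | side m j
  ... | left i  | left j  = cong (_↑ˡ n) (p (Finₚ.↑ˡ-injective n _ _
    (trans (sym (lookup-⊞ˡ i)) (trans eq (lookup-⊞ˡ j)))))
  ... | right i | right j = cong (m ↑ʳ_) (q (Finₚ.↑ʳ-injective m _ _
    (trans (sym (lookup-⊞ʳ i)) (trans eq (lookup-⊞ʳ j)))))
  ... | left i  | right j = contradiction (trans (sym (lookup-⊞ˡ i)) (trans eq (lookup-⊞ʳ j))) ↑ˡ≢↑ʳ
  ... | right i | left j  = contradiction (trans (sym (lookup-⊞ˡ j)) (trans (sym eq) (lookup-⊞ʳ i))) ↑ˡ≢↑ʳ

  perm-⊞⁻ : Perm (σ ⊞ τ) → Perm σ × Perm τ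
  perm-⊞⁻ p =
    (λ {i} {j} eq → Finₚ.↑ˡ-injective n _ _
      (p (trans (lookup-⊞ˡ i) (trans (cong (_↑ˡ n) eq) (sym (lookup-⊞ˡ j)))))) ,
    (λ {i} {j} eq → Finₚ.↑ʳ-injective m _ _
      (p (trans (lookup-⊞ʳ i) (trans (cong (m ↑ʳ_) eq) (sym (lookup-⊞ʳ j))))))

  inv-⊞ : inv (σ ⊞ τ) ≡ inv σ + inv τ
  inv-⊞ = enum-unique (enum-inv (σ ⊞ τ))
    (enum-map embed (λ {s} {t} → inj {s} {t}) (λ {s} → to {s}) from (enum-⊎ (enum-inv σ) (enum-inv τ)))
    where
    embed : (Fin m × Fin m) ⊎ (Fin n × Fin n) → Fin (m + n) × Fin (m + n)
    embed (inj₁ (i , j)) = i ↑ˡ n , j ↑ˡ n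
    embed (inj₂ (i , j)) = m ↑ʳ i , m ↑ʳ j
    R = [ Inversion σ , Inversion τ ]′
    inj : ∀ {s t} → R s → R t → embed s ≡ embed t → s ≡ t
    inj {inj₁ _} {inj₁ _} _ _ eq = cong inj₁ (cong₂ _,_
      (Finₚ.↑ˡ-injective n _ _ (cong proj₁ eq)) (Finₚ.↑ˡ-injective n _ _ (cong proj₂ eq)))
    inj {inj₂ _} {inj₂ _} _ _ eq = cong inj₂ (cong₂ _,_
      (Finₚ.↑ʳ-injective m _ _ (cong proj₁ eq)) (Finₚ.↑ʳ-injective m _ _ (cong proj₂ eq)))
    inj {inj₁ _} {inj₂ _} _ _ eq = contradiction (cong proj₁ eq) ↑ˡ≢↑ʳ
    inj {inj₂ _} {inj₁ _} _ _ eq = contradiction (sym (cong proj₁ eq)) ↑ˡ≢↑ʳ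
    to : ∀ {s} → R s → Inversion (σ ⊞ τ) (embed s)
    to {inj₁ _} (i<j , lt) = ↑ˡ-mono i<j , ⊞-monoˡ lt
    to {inj₂ _} (i<j , lt) = ↑ʳ-mono i<j , ⊞-monoʳ lt
    from : ∀ {ij} → Inversion (σ ⊞ τ) ij → ∃[ s ] R s × embed s ≡ ij
    from {i , j} (i<j , lt) with side m i | side m j
    ... | left i  | left j  = inj₁ (i , j) , (↑ˡ-cancel i<j , ⊞-cancelˡ lt) , refl
    ... | right i | right j = inj₂ (i , j) , (↑ʳ-cancel {m = m} i<j , ⊞-cancelʳ lt) , refl
    ... | left i  | right j = contradiction lt ⊞-ʳ≮ˡ
    ... | right i | left j  = contradiction i<j ↑ʳ≮↑ˡ

  -- Letters on the left are below letters on the right, so the descent 32 lies in one block; the 1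
  -- joins it on the left, or the 4 on the right.
  1324-⊞ : Has1324 (σ ⊞ τ) → Has132 σ ⊎ Has213 τ
  1324-⊞ (a , b , c , d , (a<b , b<c , c<d) , (v₁ , v₂ , v₃)) with side m a | side m b | side m c | side m d
  ... | left a  | left b  | left c  | _       = inj₁ (a , b , c ,
    ↑ˡ-cancel a<b , ↑ˡ-cancel b<c , ⊞-cancelˡ v₁ , ⊞-cancelˡ v₂)
  ... | _       | right b | right c | right d = inj₂ (b , c , d ,
    ↑ʳ-cancel {m = m} b<c , ↑ʳ-cancel {m = m} c<d , ⊞-cancelʳ v₂ , ⊞-cancelʳ v₃)
  ... | _       | left _  | right _ | _       = contradiction v₂ ⊞-ʳ≮ˡ
  ... | right _ | left _  | _       | _       = contradiction a<b ↑ʳ≮↑ˡ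
  ... | _       | right _ | left _  | _       = contradiction b<c ↑ʳ≮↑ˡ
  ... | _       | _       | right _ | left _  = contradiction c<d ↑ʳ≮↑ˡ

  -- 4231 is not a direct sum of shorter patterns, so an occurrence cannot straddle the cut.
  4231-⊞ : Has4231 (σ ⊞ τ) → Has4231 σ ⊎ Has4231 τ
  4231-⊞ (a , b , c , d , (a<b , b<c , c<d) , (v₁ , v₂ , v₃)) with side m a | side m b | side m c | side m d
  ... | left a  | left b  | left c  | left d  = inj₁ (a , b , c , d ,
    (↑ˡ-cancel a<b , ↑ˡ-cancel b<c , ↑ˡ-cancel c<d) , (⊞-cancelˡ v₁ , ⊞-cancelˡ v₂ , ⊞-cancelˡ v₃))
  ... | right a | right b | right c | right d = inj₂ (a , b , c , d ,
    (↑ʳ-cancel {m = m} a<b , ↑ʳ-cancel {m = m} b<c , ↑ʳ-cancel {m = m} c<d) ,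
    (⊞-cancelʳ v₁ , ⊞-cancelʳ v₂ , ⊞-cancelʳ v₃))
  ... | left _  | _       | right _ | _       = contradiction v₃ ⊞-ʳ≮ˡ
  ... | _       | right _ | left _  | _       = contradiction v₂ ⊞-ʳ≮ˡ
  ... | _       | left _  | _       | right _ = contradiction v₁ ⊞-ʳ≮ˡ
  ... | right _ | left _  | _       | _       = contradiction a<b ↑ʳ≮↑ˡ
  ... | _       | _       | right _ | left _  = contradiction c<d ↑ʳ≮↑ˡ

  -- The right block is nonempty, and its letter at `d` serves as the 4.
  132-⊞ : Fin n → Has132 σ → Has1324 (σ ⊞ τ)
  132-⊞ d (a , b , c , a<b , b<c , a<c , c<b) = a ↑ˡ n , b ↑ˡ n , c ↑ˡ n , m ↑ʳ d ,
    (↑ˡ-mono a<b , ↑ˡ-mono b<c , ↑ˡ<↑ʳ) , (⊞-monoˡ a<c , ⊞-monoˡ c<b , ⊞-ˡ<ʳ b d)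

  213-⊞ : Fin m → Has213 τ → Has1324 (σ ⊞ τ)
  213-⊞ a (b , c , d , b<c , c<d , c<b , b<d) = a ↑ˡ n , m ↑ʳ b , m ↑ʳ c , m ↑ʳ d ,
    (↑ˡ<↑ʳ , ↑ʳ-mono b<c , ↑ʳ-mono c<d) , (⊞-ˡ<ʳ a c , ⊞-monoʳ c<b , ⊞-monoʳ b<d)

  4231-⊞ˡ : Has4231 σ → Has4231 (σ ⊞ τ)
  4231-⊞ˡ (a , b , c , d , (a<b , b<c , c<d) , (v₁ , v₂ , v₃)) = a ↑ˡ n , b ↑ˡ n , c ↑ˡ n , d ↑ˡ n ,
    (↑ˡ-mono a<b , ↑ˡ-mono b<c , ↑ˡ-mono c<d) , (⊞-monoˡ v₁ , ⊞-monoˡ v₂ , ⊞-monoˡ v₃)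

  4231-⊞ʳ : Has4231 τ → Has4231 (σ ⊞ τ)
  4231-⊞ʳ (a , b , c , d , (a<b , b<c , c<d) , (v₁ , v₂ , v₃)) = m ↑ʳ a , m ↑ʳ b , m ↑ʳ c , m ↑ʳ d ,
    (↑ʳ-mono a<b , ↑ʳ-mono b<c , ↑ʳ-mono c<d) , (⊞-monoʳ v₁ , ⊞-monoʳ v₂ , ⊞-monoʳ v₃)

⊞-injective : ∀ {m n} {σ σ′ : Word m} {τ τ′ : Word n} → σ ⊞ τ ≡ σ′ ⊞ τ′ → σ ≡ σ′ × τ ≡ τ′
⊞-injective {m} {n} {σ} {σ′} {τ} {τ′} eq =
  lookup-ext (λ i → Finₚ.↑ˡ-injective n _ _ (trans (sym (lookup-⊞ˡ σ τ i))
    (trans (cong (λ π → lookup π (i ↑ˡ n)) eq) (lookup-⊞ˡ σ′ τ′ i)))) ,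
  lookup-ext (λ j → Finₚ.↑ʳ-injective m _ _ (trans (sym (lookup-⊞ʳ σ τ j))
    (trans (cong (λ π → lookup π (m ↑ʳ j)) eq) (lookup-⊞ʳ σ′ τ′ j))))

-- Each s < j with s ≢ i contributes an inversion: with j if its letter exceeds
-- the one at j, and otherwise with i.

inversions-before : ∀ {n} (π : Word n) → Perm π → ∀ {i j} → Inversion π (i , j) →
  (∀ s → s Fin.< i → ¬ val π s < val π j) → toℕ j ≤ inv π
inversions-before {n} π p {i} {j} (i<j , πj<πi) above =
  enum-≤ witness inj to (enum-Fin< (toℕ j) (ℕₚ.<⇒≤ (Finₚ.toℕ<n j))) (enum-inv π)
  where
  witness : Fin n → Fin n × Fin n
  witness s with lookup π j Finₚ.<? lookup π s
  ... | yes _ = s , j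
  ... | no  _ = i , s
  inj : ∀ {s t} → s Fin.< j → t Fin.< j → witness s ≡ witness t → s ≡ t
  inj {s} {t} s<j t<j eq with lookup π j Finₚ.<? lookup π s | lookup π j Finₚ.<? lookup π t
  ... | yes _ | yes _ = cong proj₁ eq
  ... | no _  | no _  = cong proj₂ eq
  ... | yes _ | no _  = contradiction t<j (ℕₚ.<-irrefl (cong toℕ (sym (cong proj₂ eq))))
  ... | no _  | yes _ = contradiction s<j (ℕₚ.<-irrefl (cong toℕ (cong proj₂ eq)))
  to : ∀ {s} → s Fin.< j → Inversion π (witness s)
  to {s} s<j with lookup π j Finₚ.<? lookup π s
  ... | yes πj<πs = s<j , πj<πs
  ... | no  πj≮πs = i<s , πs<πi
    where
    πs<πj : val π s < val π j
    πs<πj = ℕₚ.≤∧≢⇒< (ℕₚ.≮⇒≥ πj≮πs) (λ eq → ℕₚ.<-irrefl (cong toℕ (val-injective {π = π} p eq)) s<j)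
    πs<πi = ℕₚ.<-trans πs<πj πj<πi
    i<s : i Fin.< s
    i<s = ℕₚ.≤∧≢⇒< (ℕₚ.≮⇒≥ λ s<i → above s s<i πs<πj)
                    (λ eq → ℕₚ.<-irrefl (cong (val π) (Finₚ.toℕ-injective (sym eq))) πs<πi)

-- This is `inversions-before` for the reverse complement, which sends the inversion to
-- `(opposite j , opposite i)`; the bound counts the positions after `i`.
inversions-after : ∀ {n} (π : Word n) → Perm π → ∀ {i j} → Inversion π (i , j) →
  (∀ s → j Fin.< s → ¬ val π i < val π s) → n ∸ suc (toℕ i) ≤ inv π
inversions-after {n} π p {i} {j} ij below =
  subst₂ _≤_ (Finₚ.opposite-prop i) (inv-rc π)
    (inversions-before (rc π) (perm-rc {π = π} p) (rc-inversion π ij) λ s s<j′ lt →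
      below (opposite s) (subst (Fin._< opposite s) (Finₚ.opposite-involutive j) (opposite-< s<j′))
        (subst (λ π → val π i < val π (opposite s)) (rc-involutive π)
          (subst (λ i → val (rc (rc π)) i < val (rc (rc π)) (opposite s)) (Finₚ.opposite-involutive i)
            (rc-< (rc π) lt))))

-- Splitting a permutation at a cut

-- The letters at `i` and `j` are the 3 and the 2. Without a 1 before them there are at least
-- `toℕ j`, hence m inversions; without a 4 after them, at least n.
crossing⇒1324 : ∀ {m n} (π : Word (m + n)) → Perm π → inv π < m → inv π < n →
  ∀ {i j} → toℕ i < m → m ≤ toℕ j → val π j < val π i → Has1324 π
crossing⇒1324 {m} {n} π p inv<m inv<n {i} {j} i<m m≤j πj<πi
  with Finₚ.any? (λ s → s Finₚ.<? i ×-dec lookup π s Finₚ.<? lookup π j)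
     | Finₚ.any? (λ s → j Finₚ.<? s ×-dec lookup π i Finₚ.<? lookup π s)
... | yes (a , a<i , a<πj) | yes (d , j<d , πi<d) =
  a , i , j , d , (a<i , ℕₚ.≤-trans i<m m≤j , j<d) , (a<πj , πj<πi , πi<d)
... | no ¬a | _ = contradiction
  (ℕₚ.≤-trans m≤j (inversions-before π p (ℕₚ.≤-trans i<m m≤j , πj<πi) λ s s<i lt → ¬a (s , s<i , lt)))
  (ℕₚ.<⇒≱ inv<m)
... | yes _ | no ¬d = contradiction
  (ℕₚ.≤-trans (ℕₚ.≤-trans (ℕₚ.≤-reflexive (sym (ℕₚ.m+n∸m≡n m n))) (ℕₚ.∸-monoʳ-≤ (m + n) i<m))
    (inversions-after π p (ℕₚ.≤-trans i<m m≤j , πj<πi) λ s j<s lt → ¬d (s , j<s , lt)))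
  (ℕₚ.<⇒≱ inv<n)

module _ {m n : ℕ} (π : Word (m + n)) where

  PreservesLeft PreservesRight : Set
  PreservesLeft  = ∀ i → ∃[ i′ ] lookup π (i ↑ˡ n) ≡ i′ ↑ˡ n
  PreservesRight = ∀ j → ∃[ j′ ] lookup π (m ↑ʳ j) ≡ m ↑ʳ j′

  -- An injection of the left block into itself is onto, so no small letter remains for the right
  -- block.
  left⇒right : Perm π → PreservesLeft → PreservesRight
  left⇒right p L j with lookup π (m ↑ʳ j) in eq
  ... | k with side m k
  ...   | right j′ = j′ , refl
  ...   | left i′ with injective⇒surjective (proj₁ ∘ L) (λ {x} {y} f≡ → Finₚ.↑ˡ-injective n _ _ (p
                         (trans (proj₂ (L x)) (trans (cong (_↑ˡ n) f≡) (sym (proj₂ (L y))))))) i′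
  ...     | i , refl = contradiction (p (trans (proj₂ (L i)) (sym eq))) ↑ˡ≢↑ʳ

  right⇒left : Perm π → PreservesRight → PreservesLeft
  right⇒left p R i with lookup π (i ↑ˡ n) in eq
  ... | k with side m k
  ...   | left i′ = i′ , refl
  ...   | right j′ with injective⇒surjective (proj₁ ∘ R) (λ {x} {y} f≡ → Finₚ.↑ʳ-injective m _ _ (p
                          (trans (proj₂ (R x)) (trans (cong (m ↑ʳ_) f≡) (sym (proj₂ (R y))))))) j′
  ...     | j , refl = contradiction (p (trans eq (sym (proj₂ (R j))))) ↑ˡ≢↑ʳ

  preserves⇒⊞ : PreservesLeft → PreservesRight → ∃[ σ ] ∃[ τ ] σ ⊞ τ ≡ π
  preserves⇒⊞ L R = σ , τ , lookup-ext eq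
    where
    σ = tabulate (proj₁ ∘ L)
    τ = tabulate (proj₁ ∘ R)
    eq : ∀ i → lookup (σ ⊞ τ) i ≡ lookup π i
    eq i with side m i
    ... | left i  = trans (lookup-⊞ˡ σ τ i)
      (trans (cong (_↑ˡ n) (Vecₚ.lookup∘tabulate (proj₁ ∘ L) i)) (sym (proj₂ (L i))))
    ... | right j = trans (lookup-⊞ʳ σ τ j)
      (trans (cong (m ↑ʳ_) (Vecₚ.lookup∘tabulate (proj₁ ∘ R) j)) (sym (proj₂ (R j))))

  preservesLeft? : PreservesLeft ⊎ ∃[ i ] ∃[ j ] lookup π (i ↑ˡ n) ≡ m ↑ʳ j
  preservesLeft? with Finₚ.any? (λ i → m ℕₚ.≤? val π (i ↑ˡ n))
  ... | yes (i , m≤πi) = inj₂ (i , crosses m≤πi (side m (lookup π (i ↑ˡ n))))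
    where
    crosses : ∀ {k} → m ≤ toℕ k → Side m k → ∃[ j ] k ≡ m ↑ʳ j
    crosses m≤k (left i)  = contradiction m≤k (ℕₚ.<⇒≱ (↑ˡ-< i))
    crosses _   (right j) = j , refl
  ... | no ¬∃ = inj₁ λ i → stays (λ m≤ → ¬∃ (i , m≤)) (side m (lookup π (i ↑ˡ n)))
    where
    stays : ∀ {k} → ¬ m ≤ toℕ k → Side m k → ∃[ i ] k ≡ i ↑ˡ n
    stays _  (left i)  = i , refl
    stays m≰ (right j) = contradiction (↑ʳ-≥ j) m≰

  -- Suppose a left position holds a large letter. A small letter at a right position would cross it
  -- and give a 1324, so the right block is preserved; but then so is the left one.
  splits : Perm π → inv π < m → inv π < n → ¬ Has1324 π → ∃[ σ ] ∃[ τ ] σ ⊞ τ ≡ π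
  splits p inv<m inv<n ¬1324 with preservesLeft?
  ... | inj₁ L = preserves⇒⊞ L (left⇒right p L)
  ... | inj₂ (i , j , eq) = contradiction (trans (sym (proj₂ (right⇒left p R i))) eq) ↑ˡ≢↑ʳ
    where
    R : PreservesRight
    R j′ with lookup π (m ↑ʳ j′) in eq′
    ... | k with side m k
    ...   | right j″ = j″ , refl
    ...   | left i″  = contradiction
      (crossing⇒1324 {m} {n} π p inv<m inv<n (↑ˡ-< i) (↑ʳ-≥ j′)
        (subst₂ Fin._<_ (sym eq′) (sym eq) ↑ˡ<↑ʳ)) ¬1324

-- The limit

B : List Pattern
B = p1324 ∷ p4231 ∷ []

-- The right block avoids 213 rather than 132, so its reverse complement is the word with a good
-- code.
join : ∀ m n → List ℕ × List ℕ → Word (m + n)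
join m n (l , l′) = decode m l ⊞ rc (decode n l′)

module _ {m n : ℕ} {π : Word (m + n)} where

  counted⇒join : ∀ {k} → k < m → k < n → Counted B k π →
    ∃[ ls ] ((Good (proj₁ ls) × Good (proj₂ ls)) × sumₗ (proj₁ ls) + sumₗ (proj₂ ls) ≡ k) × join m n ls ≡ π
  counted⇒join k<m k<n (u , refl , ¬1324 ∷ ¬4231 ∷ [])
    with σ , τ , refl ← splits {m} {n} π (isPermutation⇒perm u) k<m k<n (¬1324 ∘ 1324⇒contains π)
    with pσ , pτ ← perm-⊞⁻ σ τ (isPermutation⇒perm u)
    with l , g , v , refl ← avoider⇒good {π = σ} pσ
           (λ h → ¬1324 (1324⇒contains (σ ⊞ τ) (132-⊞ σ τ (Fin.fromℕ< k<n) h)))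
           (λ h → ¬4231 (4231⇒contains (σ ⊞ τ) (4231-⊞ˡ σ τ h)))
       | l′ , g′ , v′ , eq ← avoider⇒good {π = rc τ} (perm-rc {π = τ} pτ)
           (λ h → ¬1324 (1324⇒contains (σ ⊞ τ) (213-⊞ σ τ (Fin.fromℕ< k<m)
                   (subst Has213 (rc-involutive τ) (rc-132 (rc τ) h)))))
           (λ h → ¬4231 (4231⇒contains (σ ⊞ τ) (4231-⊞ʳ σ τ
                   (subst Has4231 (rc-involutive τ) (rc-4231 (rc τ) h))))) =
    (l , l′) ,
    ((g , g′) , sym (trans (inv-⊞ σ τ) (cong₂ _+_ (inv-decode v)
      (trans (sym (inv-rc τ)) (trans (cong inv (sym eq)) (inv-decode v′)))))) ,
    cong (decode m l ⊞_) (trans (cong rc eq) (rc-involutive τ))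

join-counted : ∀ {m n k l l′} → k < m → k < n → Good l → Good l′ → sumₗ l + sumₗ l′ ≡ k →
  Counted B k (join m n (l , l′))
join-counted {m} {n} {l = l} {l′} k<m k<n g g′ refl =
  perm⇒isPermutation (perm-⊞ σ τ (perm-decode m l) (perm-rc {π = decode n l′} (perm-decode n l′))) ,
  trans (inv-⊞ σ τ) (cong₂ _+_ (inv-decode v) (trans (inv-rc (decode n l′)) (inv-decode v′))) ,
  ¬1324 ∘ 1324-⊞ σ τ ∘ contains⇒1324 (σ ⊞ τ) ∷ ¬4231 ∘ 4231-⊞ σ τ ∘ contains⇒4231 (σ ⊞ τ) ∷ []
  where
  σ = decode m l
  τ = rc (decode n l′)
  v  = valid-sum {m} g (ℕₚ.≤-trans (s≤s (ℕₚ.m≤m+n _ _)) k<m)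
  v′ = valid-sum {n} g′ (ℕₚ.≤-trans (s≤s (ℕₚ.m≤n+m _ _)) k<n)
  ¬1324 : ¬ (Has132 σ ⊎ Has213 τ)
  ¬1324 (inj₁ h) = good⇒¬132 g v h
  ¬1324 (inj₂ h) = good⇒¬132 g′ v′ (subst Has132 (rc-involutive (decode n l′)) (rc-213 τ h))
  ¬4231 : ¬ (Has4231 σ ⊎ Has4231 τ)
  ¬4231 (inj₁ h) = good⇒¬4231 g v h
  ¬4231 (inj₂ h) = good⇒¬4231 g′ v′ (subst Has4231 (rc-involutive (decode n l′)) (rc-4231 τ h))

av-split : ∀ m n k → k < m → k < n → av B (m + n) k ≡ ((P∞ ⊕ S∞) ⊗ (P∞ ⊕ S∞)) k
av-split m n k k<m k<n = enum-unique (enum-av B (m + n) k)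
  (enum-map (join m n) inj (λ ((g , g′) , eq) → join-counted k<m k<n g g′ eq) (counted⇒join k<m k<n)
    (enum-convolution enum-good enum-good k))
  where
  inj : ∀ {s t : List ℕ × List ℕ} →
    ((Good (proj₁ s) × Good (proj₂ s)) × sumₗ (proj₁ s) + sumₗ (proj₂ s) ≡ k) →
    ((Good (proj₁ t) × Good (proj₂ t)) × sumₗ (proj₁ t) + sumₗ (proj₂ t) ≡ k) →
    join m n s ≡ join m n t → s ≡ t
  inj {l₁ , l₂} {l₃ , l₄} ((g₁ , g₂) , eq₁) ((g₃ , g₄) , eq₂) eq
    with σ≡ , τ≡ ← ⊞-injective {m} {n} {decode m l₁} {decode m l₃} eq =
    cong₂ _,_
      (decode-injective g₁ g₃ (valid g₁ (ℕₚ.m≤m+n _ _) eq₁ k<m) (valid g₃ (ℕₚ.m≤m+n _ _) eq₂ k<m) σ≡)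
      (decode-injective g₂ g₄ (valid g₂ (ℕₚ.m≤n+m _ _) eq₁ k<n) (valid g₄ (ℕₚ.m≤n+m _ _) eq₂ k<n)
        (trans (sym (rc-involutive (decode n l₂))) (trans (cong rc τ≡) (rc-involutive (decode n l₄)))))
    where
    valid : ∀ {m l s} → Good l → sumₗ l ≤ s → s ≡ k → k < m → Valid m l
    valid g l≤s refl k<m = valid-sum g (ℕₚ.≤-trans (s≤s l≤s) k<m)

proposition5p9 : ∃[ P ] ∃[ S ]
    HasProduct 1+x^ P ×
    HasDoubleSum summand S ×
    IsLimitGF (p1324 ∷ p4231 ∷ []) ((P ⊕ S) ⊗ (P ⊕ S))
proposition5p9 = P∞ , S∞ ,
  (λ k → k , λ n n≥k → ∏-stable n≥k) ,
  (λ k → k , λ M N M≥k N≥k → ∑<<-stable M≥k N≥k) ,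
  -- From length 2(k + 1) on, the cut at k + 1 leaves more than k letters on both sides.
  (λ k → suc k + suc k , λ n n≥ → subst (λ n → av B n k ≡ _)
    (ℕₚ.m+[n∸m]≡n (ℕₚ.m+n≤o⇒m≤o (suc k) n≥))
    (av-split (suc k) (n ∸ suc k) k ℕₚ.≤-refl
      (subst (_≤ n ∸ suc k) (ℕₚ.m+n∸m≡n (suc k) (suc k)) (ℕₚ.∸-monoˡ-≤ (suc k) n≥))))
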